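{- Let $n\geqslant r\geqslant 3$ and $k\geqslant 3$ be integers, and let $H$ be the balanced complete $k$-partite $r$-uniform hypergraph with $n$ vertices in each class. If $k\equiv 0 \pmod 3$, the $3$-coloring (colors red, blue, green) minimizing the number of monochromatic edges of $H$ is: color all vertices of the first $k/3$ classes red, all vertices of the next $k/3$ classes blue, and all vertices of the last $k/3$ classes green. If $k\equiv 1\pmod 3$, the $3$-coloring minimizing the number of monochromatic edges of $H$ is: color all vertices of the first $\lfloor k/3\rfloor$ classes red, all vertices of the next $\lfloor k/3\rfloor$ classes blue, all vertices of the next $\lfloor k/3\rfloor$ classes green, and color the vertices of the last class so that the numbers of red, blue and green vertices in it are as equal as possible (i.e. pairwise differ by at most $1$). Moreover, in each case the minimizing coloring is unique up to a permutation of colors and classes.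
   Context: The balanced complete $k$-partite $r$-uniform hypergraph with $n$ vertices in each class has vertex set the disjoint union of $k$ classes $V_1,\dots,V_k$ with $|V_i|=n$, and its edges are all $r$-element subsets of $V_1\cup\dots\cup V_k$ that are not contained in a single class $V_i$ (an edge may contain several vertices of the same class). A $3$-coloring assigns to each vertex one of three colors (not required to be proper). An edge is monochromatic if all its vertices have the same color. Colorings having the same number of vertices of each color in each class are regarded as the same coloring. -}

module Defs where

open import Data.Fin.Base using (Fin; zero; suc; toℕ; quotient)
open import Data.Fin.Patterns using (0F; 1F; 2F)
open import Data.Fin.Permutation using (Permutation′; _⟨$⟩ʳ_)
open import Data.Fin.Properties using (_≟_; any?; all?)
open import Data.Fin.Subset using (Subset; _∈_; ∣_∣; inside; outside)
open import Data.Fin.Subset.Properties using (_∈?_)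
open import Data.List.Base using (List; []; _∷_; _++_; map; filter; length; allFin)
open import Data.Nat.Base using (ℕ; zero; suc; _+_; _*_; _≤_; _<_)
import Data.Nat.Properties as ℕ
open import Data.Product using (∃-syntax; _×_)
import Data.Vec.Base as Vec
open import Relation.Binary.PropositionalEquality using (_≡_)
open import Relation.Nullary.Decidable using (Dec; ¬?; _×-dec_; _→-dec_)
open import Relation.Nullary.Negation using (¬_)

Color : Set
Color = Fin 3

pattern red   = 0F
pattern blue  = 1F
pattern green = 2F

-- Every subset of Fin m, each listed exactly once.
subsets : ∀ m → List (Subset m)
subsets zero    = Vec.[] ∷ []
subsets (suc m) = map (inside Vec.∷_) (subsets m) ++ map (outside Vec.∷_) (subsets m)

module BalancedCompleteHypergraph (k n r : ℕ) where

  -- The disjoint union of k classes of n vertices, through the bijection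
  -- Fin (k * n) ↔ Fin k × Fin n given by division by n.
  Vertex : Set
  Vertex = Fin (k * n)

  class : Vertex → Fin k
  class = quotient n

  ContainedInAClass : Subset (k * n) → Set
  ContainedInAClass e = ∃[ i ] (∀ v → v ∈ e → class v ≡ i)

  IsEdge : Subset (k * n) → Set
  IsEdge e = ∣ e ∣ ≡ r × ¬ ContainedInAClass e

  isEdge? : ∀ e → Dec (IsEdge e)
  isEdge? e =
    (∣ e ∣ ℕ.≟ r) ×-dec
    ¬? (any? λ i → all? λ v → (v ∈? e) →-dec (class v ≟ i))

  edges : List (Subset (k * n))
  edges = filter isEdge? (subsets (k * n))

  Coloring : Set
  Coloring = Vertex → Color

  Monochromatic : Coloring → Subset (k * n) → Set
  Monochromatic χ e = ∃[ c ] (∀ v → v ∈ e → χ v ≡ c)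

  monochromatic? : ∀ χ e → Dec (Monochromatic χ e)
  monochromatic? χ e = any? λ c → all? λ v → (v ∈? e) →-dec (χ v ≟ c)

  #monochromatic : Coloring → ℕ
  #monochromatic χ = length (filter (monochromatic? χ) edges)

  Minimizing : Coloring → Set
  Minimizing χ = ∀ χ′ → #monochromatic χ ≤ #monochromatic χ′

  #colored : Coloring → Fin k → Color → ℕ
  #colored χ i c =
    length (filter (λ v → (class v ≟ i) ×-dec (χ v ≟ c)) (allFin (k * n)))

  -- Colorings with the same number of vertices of each color in each class
  -- are identified, so sameness up to permuting colors and classes only
  -- compares these numbers.
  _≈_ : Coloring → Coloring → Set
  χ ≈ χ′ = ∃[ π ] ∃[ σ ] SameCounts π σ
    where
    SameCounts : Permutation′ k → Permutation′ 3 → Set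
    SameCounts π σ = ∀ i c → #colored χ (π ⟨$⟩ʳ i) (σ ⟨$⟩ʳ c) ≡ #colored χ′ i c

  -- The first m classes are red, the next m blue and the next m green;
  -- nothing is required of any further class.
  ThreeBlocks : ℕ → Coloring → Set
  ThreeBlocks m χ = ∀ v → let i = toℕ (class v) in
    (i < m → χ v ≡ red) ×
    (m ≤ i → i < 2 * m → χ v ≡ blue) ×
    (2 * m ≤ i → i < 3 * m → χ v ≡ green)

  LastClassBalanced : Coloring → Set
  LastClassBalanced χ = ∀ i → suc (toℕ i) ≡ k →
    ∀ c d → #colored χ i c ≤ #colored χ i d + 1

{-# OPTIONS --safe #-}
module Submission where

-- Filling classes greedily shows that x vertices of one color contain at least
-- h x = C(x,r) - (x/n) C(n,r) - C(x%n,r) monochromatic edges, and when equality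
-- holds exactly x/n classes are completely of that color. The function h is
-- convex, strictly so beyond n - 1, so the sum of h over the three colors is
-- bounded below by the tangent line at m = ⌊k n / 3⌋, touched only at m and m + 1.
-- For k ≡ 0 and k ≡ 1 (mod 3) both bounds are attained simultaneously, and
-- equality in them leaves only permutations of classes and colors.

-- Only the numbers of vertices of each color in each class matter, since the monochromatic edges
-- are the one-colored `r`-subsets minus those inside a class. Convexity of `h` is not inherited
-- termwise: the greedy count is subtracted, and its increments drop whenever a class becomes full.
-- A drop in what is subtracted, however, only raises the increment of `h`. Equality in the greedy
-- bound does not determine a column, because parts with fewer than `r` vertices contribute nothing
-- however they are spread. It does determine the number of full classes. Both admissible totals
-- leave the same quotient `q` by `n`, so the three colors fill `3 * q` classes; at most one class
-- is left, and its row is what the color totals leave over.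

open import Defs
open import Data.Bool using (if_then_else_; true; false)
open import Data.Fin using (Fin; zero; suc; combine; remQuot; punchOut; toℕ; _↑ˡ_; _↑ʳ_)
open import Data.Fin.Permutation as Permutation using (_⟨$⟩ʳ_; insert; insert-punchIn)
import Data.Fin.Properties as Fin
open import Data.Fin.Properties using (any?; all?)
open import Data.Fin.Subset using (Subset; Nonempty; _∈_; ∣_∣; inside; outside)
open import Data.Fin.Subset.Properties using (_∈?_)
open import Data.List using (List; []; _∷_; _++_; map; filter; length; tabulate; allFin)
open import Data.Maybe using (Maybe; just; nothing)
open import Data.Maybe.Properties using (≡-dec)
open import Data.Nat using (ℕ; zero; suc; _+_; _*_; _∸_; _≤_; _<_; _≥_; z≤n; s≤s; s≤s⁻¹; _/_; _%_; NonZero; >-nonZero; _≟_; _<?_)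
open import Data.Nat.Combinatorics using (_C_; nCk+nC[k+1]≡[n+1]C[k+1]; k>n⇒nCk≡0; nCn≡1)
open import Data.Nat.Divisibility using (n∣m*n)
open import Data.Nat.DivMod
open import Data.Nat.Properties hiding (_≟_; _<?_)
open import Algebra.Properties.Semiring.Sum +-*-semiring
open import Data.Nat.Tactic.RingSolver using (solve-∀)
open import Data.Product using (∃; ∃-syntax; Σ-syntax; _×_; _,_; proj₁; proj₂)
open import Data.Sum using (_⊎_; inj₁; inj₂)
open import Data.Vec using ([]; _∷_; here; there)
open import Data.Vec.Functional using (removeAt)
open import Function using (_∘_; id)
open import Relation.Binary.Definitions using (DecidableEquality)
open import Relation.Binary.PropositionalEquality
open import Relation.Nullary using (Dec; yes; no; ¬_; contradiction; does)
open import Relation.Nullary.Decidable using (_×-dec_; _→-dec_; dec-true; dec-false)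

-- Indicators and finite sums

⟦_⟧ : ∀ {p} {P : Set p} → Dec P → ℕ
⟦ d ⟧ = if does d then 1 else 0

⟦⟧-true : ∀ {P : Set} (d : Dec P) → P → ⟦ d ⟧ ≡ 1
⟦⟧-true d p = cong (if_then 1 else 0) (dec-true d p)

⟦⟧-false : ∀ {P : Set} (d : Dec P) → ¬ P → ⟦ d ⟧ ≡ 0
⟦⟧-false d ¬p = cong (if_then 1 else 0) (dec-false d ¬p)

⟦⟧-⇔ : ∀ {P Q : Set} (d : Dec P) (e : Dec Q) → (P → Q) → (Q → P) → ⟦ d ⟧ ≡ ⟦ e ⟧
⟦⟧-⇔ (yes p) e f g = sym (⟦⟧-true e (f p))
⟦⟧-⇔ (no ¬p) e f g = sym (⟦⟧-false e (¬p ∘ g))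

-- Sums of indicators over classes or colors become a single indicator, so that counting identities
-- can be argued between propositions.
sum-⟦⟧-unique : ∀ {k} {P : Fin k → Set} {Q : Set} (P? : ∀ i → Dec (P i)) (Q? : Dec Q) →
  (∀ i j → P i → P j → i ≡ j) → (∀ i → P i → Q) → (Q → ∃ P) →
  ∑[ i < k ] ⟦ P? i ⟧ ≡ ⟦ Q? ⟧
sum-⟦⟧-unique {zero} P? Q? uniq sound complete =
  sym (⟦⟧-false Q? λ q → Fin.¬Fin0 (proj₁ (complete q)))
sum-⟦⟧-unique {suc k} {P} P? Q? uniq sound complete with P? zero
... | yes p₀ = begin
  1 + ∑[ i < k ] ⟦ P? (suc i) ⟧ ≡⟨ cong suc (sum-cong-≗ λ i → ⟦⟧-false (P? (suc i)) λ p → Fin.0≢1+n (uniq zero (suc i) p₀ p)) ⟩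
  1 + ∑[ i < k ] 0              ≡⟨ cong suc (sum-replicate-zero k) ⟩
  1                             ≡⟨ ⟦⟧-true Q? (sound zero p₀) ⟨
  ⟦ Q? ⟧                        ∎
  where open ≡-Reasoning
... | no ¬p₀ = sum-⟦⟧-unique (P? ∘ suc) Q?
  (λ i j p p′ → Fin.suc-injective (uniq (suc i) (suc j) p p′))
  (λ i → sound (suc i)) (down ∘ complete)
  where
  down : ∃ P → ∃ (P ∘ suc)
  down (zero  , p) = contradiction p ¬p₀
  down (suc i , p) = i , p

sum-1 : ∀ k → ∑[ i < k ] 1 ≡ k
sum-1 zero    = refl
sum-1 (suc k) = cong suc (sum-1 k)

sum-const : ∀ k x → ∑[ i < k ] x ≡ k * x
sum-const zero    x = refl
sum-const (suc k) x = cong (x +_) (sum-const k x)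

sum-mono : ∀ {k} {f g : Fin k → ℕ} → (∀ i → f i ≤ g i) → sum f ≤ sum g
sum-mono {zero}  f≤g = z≤n
sum-mono {suc k} f≤g = +-mono-≤ (f≤g zero) (sum-mono (f≤g ∘ suc))

-- This carries equality in a bound summed over the colors back to each single color.
sum-mono-≡ : ∀ {k} {f g : Fin k → ℕ} → (∀ i → f i ≤ g i) → sum g ≤ sum f → ∀ i → f i ≡ g i
sum-mono-≡ {suc k} {f} {g} f≤g g≤f zero = ≤-antisym (f≤g zero)
  (+-cancelʳ-≤ (sum (g ∘ suc)) (g zero) (f zero)
    (≤-trans g≤f (+-monoʳ-≤ (f zero) (sum-mono (f≤g ∘ suc)))))
sum-mono-≡ {suc k} {f} {g} f≤g g≤f (suc i) = sum-mono-≡ (f≤g ∘ suc)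
  (+-cancelˡ-≤ (g zero) _ _ (≤-trans g≤f (+-monoˡ-≤ (sum (f ∘ suc)) (f≤g zero)))) i

sum-≥ : ∀ {k} (f : Fin k → ℕ) i → f i ≤ sum f
sum-≥ f zero    = m≤m+n _ _
sum-≥ f (suc i) = ≤-trans (sum-≥ (f ∘ suc) i) (m≤n+m _ _)

sum-+ : ∀ m n (f : Fin (m + n) → ℕ) → sum f ≡ ∑[ i < m ] f (i ↑ˡ n) + ∑[ i < n ] f (m ↑ʳ i)
sum-+ zero    n f = refl
sum-+ (suc m) n f = trans (cong (f zero +_) (sum-+ m n (f ∘ suc))) (sym (+-assoc (f zero) _ _))

sum-combine : ∀ m n (f : Fin (m * n) → ℕ) → sum f ≡ ∑[ i < m ] ∑[ j < n ] f (combine i j)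
sum-combine zero    n f = refl
sum-combine (suc m) n f = trans (sum-+ n (m * n) f)
  (cong (∑[ j < n ] f (j ↑ˡ (m * n)) +_) (sum-combine m n (f ∘ (n ↑ʳ_))))

-- Totals over lists

private variable A : Set

total : (A → ℕ) → List A → ℕ
total f []       = 0
total f (x ∷ xs) = f x + total f xs

total-++ : ∀ (f : A → ℕ) xs ys → total f (xs ++ ys) ≡ total f xs + total f ys
total-++ f []       ys = refl
total-++ f (x ∷ xs) ys = trans (cong (f x +_) (total-++ f xs ys)) (sym (+-assoc (f x) _ _))

total-map : ∀ {B : Set} (f : B → ℕ) (g : A → B) xs → total f (map g xs) ≡ total (f ∘ g) xs
total-map f g []       = refl
total-map f g (x ∷ xs) = cong (_ +_) (total-map f g xs)

total-cong : ∀ {f g : A → ℕ} → (∀ x → f x ≡ g x) → ∀ xs → total f xs ≡ total g xs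
total-cong f≗g []       = refl
total-cong f≗g (x ∷ xs) = cong₂ _+_ (f≗g x) (total-cong f≗g xs)

total-0 : ∀ {f : A → ℕ} → (∀ x → f x ≡ 0) → ∀ xs → total f xs ≡ 0
total-0 f≗0 []       = refl
total-0 f≗0 (x ∷ xs) = cong₂ _+_ (f≗0 x) (total-0 f≗0 xs)

total-+ : ∀ (f g : A → ℕ) xs → total (λ x → f x + g x) xs ≡ total f xs + total g xs
total-+ f g []       = refl
total-+ f g (x ∷ xs) = trans (cong (f x + g x +_) (total-+ f g xs)) (interchange (f x) (g x) (total f xs) (total g xs))
  where
  interchange : ∀ a b c d → a + b + (c + d) ≡ a + c + (b + d)
  interchange = solve-∀

total-∑ : ∀ {k} (f : Fin k → A → ℕ) xs → total (λ x → ∑[ i < k ] f i x) xs ≡ ∑[ i < k ] total (f i) xs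
total-∑ {k = k} f []       = sym (sum-replicate-zero k)
total-∑ f (x ∷ xs) = trans (cong (_ +_) (total-∑ f xs)) (sym (∑-distrib-+ (λ i → f i x) (λ i → total (f i) xs)))

length-filter : ∀ {P : A → Set} (P? : ∀ x → Dec (P x)) xs → length (filter P? xs) ≡ total (⟦_⟧ ∘ P?) xs
length-filter P? []       = refl
length-filter P? (x ∷ xs) with does (P? x)
... | true  = cong suc (length-filter P? xs)
... | false = length-filter P? xs

length-filter-filter : ∀ {P Q : A → Set} (P? : ∀ x → Dec (P x)) (Q? : ∀ x → Dec (Q x)) xs →
  length (filter Q? (filter P? xs)) ≡ total (λ x → ⟦ P? x ×-dec Q? x ⟧) xs
length-filter-filter P? Q? []       = refl
length-filter-filter P? Q? (x ∷ xs) with does (P? x)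
... | false = length-filter-filter P? Q? xs
... | true with does (Q? x)
...   | true  = cong suc (length-filter-filter P? Q? xs)
...   | false = length-filter-filter P? Q? xs

total-tabulate : ∀ {k} (g : A → ℕ) (f : Fin k → A) → total g (tabulate f) ≡ ∑[ i < k ] g (f i)
total-tabulate {k = zero}  g f = refl
total-tabulate {k = suc k} g f = cong (_ +_) (total-tabulate g (f ∘ suc))

-- Counting subsets of given size inside a decidable set

Within : ∀ {N} → (Fin N → Set) → Subset N → Set
Within P e = ∀ v → v ∈ e → P v

within? : ∀ {N} {P : Fin N → Set} → (∀ v → Dec (P v)) → ∀ e → Dec (Within P e)
within? P? e = all? λ v → (v ∈? e) →-dec P? v

pascal : ∀ n k → suc n C suc k ≡ n C k + n C suc k
pascal n k = sym (nCk+nC[k+1]≡[n+1]C[k+1] n k)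

-- Splitting by membership of the first vertex is Pascal's rule when that vertex satisfies `P`;
-- otherwise only the subsets avoiding it contribute.
count-subsets : ∀ N s {P : Fin N → Set} (P? : ∀ v → Dec (P v)) →
  total (λ e → ⟦ (∣ e ∣ ≟ s) ×-dec within? P? e ⟧) (subsets N) ≡ (∑[ v < N ] ⟦ P? v ⟧) C s
count-subsets zero zero    P? = refl
count-subsets zero (suc s) P? = sym (k>n⇒nCk≡0 {0} {suc s} (s≤s z≤n))
count-subsets (suc N) s {P} P? =
  trans (total-++ f (map (inside ∷_) (subsets N)) _)
    (trans (cong₂ _+_ (total-map f (inside ∷_) (subsets N)) (trans (total-map f (outside ∷_) (subsets N)) outs))
      (helper s refl (P? zero)))
  where
  f : Subset (suc N) → ℕ
  f e = ⟦ (∣ e ∣ ≟ s) ×-dec within? P? e ⟧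
  X : ℕ
  X = ∑[ v < N ] ⟦ P? (suc v) ⟧
  outs : total (f ∘ (outside ∷_)) (subsets N) ≡ X C s
  outs = trans
    (total-cong (λ e → ⟦⟧-⇔ ((∣ outside ∷ e ∣ ≟ s) ×-dec within? P? (outside ∷ e)) ((∣ e ∣ ≟ s) ×-dec within? (P? ∘ suc) e)
       (λ (p , w) → p , λ v v∈e → w (suc v) (there v∈e))
       (λ (p , w) → p , λ { (suc v) (there v∈e) → w v v∈e })) (subsets N))
    (count-subsets N s (P? ∘ suc))
  helper : ∀ s′ → s′ ≡ s → (d : Dec (P zero)) → total (f ∘ (inside ∷_)) (subsets N) + X C s ≡ (⟦ d ⟧ + X) C s
  helper s′ eq (no ¬p₀) = cong (_+ X C s) (total-0 (λ e → ⟦⟧-false ((∣ inside ∷ e ∣ ≟ s) ×-dec within? P? (inside ∷ e)) λ (_ , w) → ¬p₀ (w zero here)) (subsets N))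
  helper zero refl (yes p₀) = cong (_+ X C 0) (total-0 (λ e → ⟦⟧-false ((suc ∣ e ∣ ≟ 0) ×-dec within? P? (inside ∷ e)) λ { (() , _) }) (subsets N))
  helper (suc t) refl (yes p₀) = trans (cong (_+ X C suc t) (trans
    (total-cong (λ e → ⟦⟧-⇔ ((suc ∣ e ∣ ≟ suc t) ×-dec within? P? (inside ∷ e)) ((∣ e ∣ ≟ t) ×-dec within? (P? ∘ suc) e)
       (λ (p , w) → suc-injective p , λ v v∈e → w (suc v) (there v∈e))
       (λ (p , w) → cong suc p , λ { zero _ → p₀ ; (suc v) (there v∈e) → w v v∈e })) (subsets N))
    (count-subsets N t (P? ∘ suc))))
    (sym (pascal X t))

-- Monotonicity and convexity of binomial coefficients

≤⇒∃+ : ∀ {m n} → m ≤ n → ∃[ o ] o + m ≡ n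
≤⇒∃+ {m} {n} m≤n = n ∸ m , m∸n+n≡m m≤n

C-monoˡ-+ : ∀ d m k → m C k ≤ (d + m) C k
C-monoˡ-+ zero    m k       = ≤-refl
C-monoˡ-+ (suc d) m zero    = ≤-refl
C-monoˡ-+ (suc d) m (suc k) = ≤-trans (C-monoˡ-+ d m (suc k))
  (≤-trans (m≤n+m _ _) (≤-reflexive (sym (pascal (d + m) k))))

C-monoˡ-≤ : ∀ {m n} k → m ≤ n → m C k ≤ n C k
C-monoˡ-≤ {m} {n} k m≤n = subst (λ x → m C k ≤ x C k) (m∸n+n≡m m≤n) (C-monoˡ-+ (n ∸ m) m k)

C-positive : ∀ {n k} → k ≤ n → 0 < n C k
C-positive {n} {k} k≤n = ≤-trans (≤-reflexive (sym (nCn≡1 k))) (C-monoˡ-≤ k k≤n)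

C-monoˡ-< : ∀ {m n k} → m < n → k < n → m C suc k < n C suc k
C-monoˡ-< {m} {suc n} {k} (s≤s m≤n) (s≤s k≤n) = begin-strict
  m C suc k           ≤⟨ C-monoˡ-≤ (suc k) m≤n ⟩
  n C suc k           <⟨ m<n+m _ (C-positive k≤n) ⟩
  n C k + n C suc k   ≡⟨ pascal n k ⟨
  suc n C suc k       ∎
  where open ≤-Reasoning

-- By Pascal's rule a unit step gains a binomial coefficient with smaller lower index, which is
-- monotone; hence the gain over `d` steps grows with the starting point.
C-supermodular : ∀ {a b} d k → a ≤ b → (d + a) C k + b C k ≤ (d + b) C k + a C k
C-supermodular {a} {b} d zero a≤b = ≤-refl
C-supermodular {a} {b} zero (suc k) a≤b = ≤-reflexive (+-comm (a C suc k) (b C suc k))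
C-supermodular {a} {b} (suc d) (suc k) a≤b = begin
  suc (d + a) C suc k + b C suc k                ≡⟨ cong (_+ b C suc k) (pascal (d + a) k) ⟩
  (d + a) C k + (d + a) C suc k + b C suc k      ≡⟨ +-assoc ((d + a) C k) _ _ ⟩
  (d + a) C k + ((d + a) C suc k + b C suc k)    ≤⟨ +-mono-≤ (C-monoˡ-≤ k (+-monoʳ-≤ d a≤b)) (C-supermodular d (suc k) a≤b) ⟩
  (d + b) C k + ((d + b) C suc k + a C suc k)    ≡⟨ +-assoc ((d + b) C k) _ _ ⟨
  (d + b) C k + (d + b) C suc k + a C suc k      ≡⟨ cong (_+ a C suc k) (pascal (d + b) k) ⟨
  suc (d + b) C suc k + a C suc k                ∎
  where open ≤-Reasoning

-- The strict inequality comes from the last of the 1 + d unit steps.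
C-supermodular-< : ∀ {a b} d k → a < b → suc k ≤ d + b →
  (suc d + a) C suc (suc k) + b C suc (suc k) < (suc d + b) C suc (suc k) + a C suc (suc k)
C-supermodular-< {a} {b} d k a<b k<d+b = begin-strict
  suc (d + a) C suc j + b C suc j                ≡⟨ cong (_+ b C suc j) (pascal (d + a) j) ⟩
  (d + a) C j + (d + a) C suc j + b C suc j      ≡⟨ +-assoc ((d + a) C j) _ _ ⟩
  (d + a) C j + ((d + a) C suc j + b C suc j)    <⟨ +-mono-<-≤ (C-monoˡ-< (+-monoʳ-< d a<b) k<d+b) (C-supermodular d (suc j) (<⇒≤ a<b)) ⟩
  (d + b) C j + ((d + b) C suc j + a C suc j)    ≡⟨ +-assoc ((d + b) C j) _ _ ⟨
  (d + b) C j + (d + b) C suc j + a C suc j      ≡⟨ cong (_+ a C suc j) (pascal (d + b) j) ⟨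
  suc (d + b) C suc j + a C suc j                ∎
  where
  open ≤-Reasoning
  j = suc k

-- Tangent lines of a convex sequence

module Tangent (h δ : ℕ → ℕ) (h-suc : ∀ x → h (suc x) ≡ h x + δ x) (δ-mono : ∀ x → δ x ≤ δ (suc x)) where

  δ-mono-+ : ∀ d x → δ x ≤ δ (d + x)
  δ-mono-+ zero    x = ≤-refl
  δ-mono-+ (suc d) x = ≤-trans (δ-mono-+ d x) (δ-mono (d + x))

  above : ∀ m j → h m + j * δ m ≤ h (j + m)
  above m zero    = ≤-reflexive (+-identityʳ (h m))
  above m (suc j) = begin
    h m + (δ m + j * δ m)    ≡⟨ rearrange (h m) (δ m) (j * δ m) ⟩
    h m + j * δ m + δ m      ≤⟨ +-mono-≤ (above m j) (δ-mono-+ j m) ⟩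
    h (j + m) + δ (j + m)    ≡⟨ h-suc (j + m) ⟨
    h (suc (j + m))          ∎
    where
    open ≤-Reasoning
    rearrange : ∀ a b c → a + (b + c) ≡ a + c + b
    rearrange = solve-∀

  below : ∀ x j → h (j + x) ≤ h x + j * δ (j + x)
  below x zero    = ≤-reflexive (sym (+-identityʳ (h x)))
  below x (suc j) = begin
    h (suc (j + x))                        ≡⟨ h-suc (j + x) ⟩
    h (j + x) + δ (j + x)                  ≤⟨ +-monoˡ-≤ _ (below x j) ⟩
    h x + j * δ (j + x) + δ (j + x)        ≤⟨ +-mono-≤ (+-monoʳ-≤ (h x) (*-monoʳ-≤ j (δ-mono (j + x)))) (δ-mono (j + x)) ⟩
    h x + j * δ′ + δ′                      ≡⟨ rearrange (h x) δ′ (j * δ′) ⟩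
    h x + (δ′ + j * δ′)                    ∎
    where
    open ≤-Reasoning
    δ′ = δ (suc (j + x))
    rearrange : ∀ a b c → a + c + b ≡ a + (b + c)
    rearrange = solve-∀

  -- The line is `h m` plus `δ m` times the signed distance from `m` to `x`. Moving `δ m * m` to the
  -- other side avoids negative terms, and one statement covers both sides of `m`.
  tangent : ∀ m x → h m + δ m * x ≤ h x + δ m * m
  tangent m x with ≤-total m x
  ... | inj₁ m≤x with j , refl ← ≤⇒∃+ m≤x = begin
    h m + δ m * (j + m)        ≡⟨ rearrange (h m) (δ m) j m ⟩
    h m + j * δ m + δ m * m    ≤⟨ +-monoˡ-≤ _ (above m j) ⟩
    h (j + m) + δ m * m        ∎
    where
    open ≤-Reasoning
    rearrange : ∀ a d j m → a + d * (j + m) ≡ a + j * d + d * m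
    rearrange = solve-∀
  ... | inj₂ x≤m with j , refl ← ≤⇒∃+ x≤m = begin
    h (j + x) + d * x          ≤⟨ +-monoˡ-≤ _ (below x j) ⟩
    h x + j * d + d * x        ≡⟨ rearrange (h x) d j x ⟨
    h x + d * (j + x)          ∎
    where
    open ≤-Reasoning
    d = δ (j + x)
    rearrange : ∀ a d j m → a + d * (j + m) ≡ a + j * d + d * m
    rearrange = solve-∀

  -- Each bound comes from the tangent lines at two consecutive points,
  -- whose slopes differ by g.
  tangent-≡⇒≤ : ∀ m x → δ m < δ (suc m) → h m + δ m * x ≡ h x + δ m * m → x ≤ suc m
  tangent-≡⇒≤ m x δ< eq with g , g+δ≡ ← ≤⇒∃+ δ< = *-cancelˡ-≤ (suc g) (+-cancelˡ-≤ (h m + δ m * x + δ m) _ _ (begin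
    h m + δ m * x + δ m + suc g * x            ≡⟨ left (h m) (δ m) x g ⟩
    h m + δ m + (g + suc (δ m)) * x            ≡⟨ cong₂ (λ a b → a + b * x) (sym (h-suc m)) g+δ≡ ⟩
    h (suc m) + δ (suc m) * x                  ≤⟨ tangent (suc m) x ⟩
    h x + δ (suc m) * suc m                    ≡⟨ cong (λ b → h x + b * suc m) g+δ≡ ⟨
    h x + (g + suc (δ m)) * suc m              ≡⟨ right (h x) (δ m) m g ⟩
    h x + δ m * m + δ m + suc g * suc m        ≡⟨ cong (λ b → b + δ m + suc g * suc m) eq ⟨
    h m + δ m * x + δ m + suc g * suc m        ∎))
    where
    open ≤-Reasoning
    left : ∀ a d x g → a + d * x + d + suc g * x ≡ a + d + (g + suc d) * x
    left = solve-∀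
    right : ∀ a d m g → a + (g + suc d) * suc m ≡ a + d * m + d + suc g * suc m
    right = solve-∀

  tangent-≡⇒≥ : ∀ y x → δ y < δ (suc y) → h (suc y) + δ (suc y) * x ≡ h x + δ (suc y) * suc y → suc y ≤ x
  tangent-≡⇒≥ y x δ< eq with g , g+δ≡ ← ≤⇒∃+ δ< = *-cancelˡ-≤ (suc g) (+-cancelˡ-≤ (h x + δ y * y + δ y) _ _ (begin
    h x + δ y * y + δ y + suc g * suc y        ≡⟨ right (h x) (δ y) y g ⟨
    h x + (g + suc (δ y)) * suc y              ≡⟨ cong (λ b → h x + b * suc y) g+δ≡ ⟩
    h x + δ (suc y) * suc y                    ≡⟨ eq ⟨
    h (suc y) + δ (suc y) * x                  ≡⟨ cong₂ (λ a b → a + b * x) (sym (h-suc y)) g+δ≡ ⟨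
    h y + δ y + (g + suc (δ y)) * x            ≡⟨ left (h y) (δ y) x g ⟨
    h y + δ y * x + δ y + suc g * x            ≤⟨ +-monoˡ-≤ (suc g * x) (+-monoˡ-≤ (δ y) (tangent y x)) ⟩
    h x + δ y * y + δ y + suc g * x            ∎))
    where
    open ≤-Reasoning
    left : ∀ a d x g → a + d * x + d + suc g * x ≡ a + d + (g + suc d) * x
    left = solve-∀
    right : ∀ a d m g → a + (g + suc d) * suc m ≡ a + d * m + d + suc g * suc m
    right = solve-∀

  -- The slope is the forward difference, so the line passes through the points at `m` and `m + 1`;
  -- slopes growing strictly into and out of `δ m` exclude every other point. Writing `m` as `suc y`
  -- makes the preceding slope available.
  tangent-≡ : ∀ y x → δ y < δ (suc y) → δ (suc y) < δ (suc (suc y)) →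
    h (suc y) + δ (suc y) * x ≡ h x + δ (suc y) * suc y → x ≡ suc y ⊎ x ≡ suc (suc y)
  tangent-≡ y x δ<₁ δ<₂ eq with m≤n⇒m<n∨m≡n (tangent-≡⇒≤ (suc y) x δ<₂ eq)
  ... | inj₁ (s≤s x≤m) = inj₁ (≤-antisym x≤m (tangent-≡⇒≥ y x δ<₁ eq))
  ... | inj₂ x≡m+1     = inj₂ x≡m+1

-- Greedy packing of one color into classes

-- p + 3 is the uniformity of the hypergraph.
module Packing (n p : ℕ) (r≤n : 3 + p ≤ n) .{{_ : NonZero n}} where

  r = 3 + p

  -- `D` and `E` are the first and second differences of `B`, by Pascal's rule.
  B D E : ℕ → ℕ
  B x = x C r
  D x = x C (2 + p)
  E x = x C (1 + p)

  B-suc : ∀ x → B (suc x) ≡ D x + B x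
  B-suc x = pascal x (2 + p)

  D-suc : ∀ x → D (suc x) ≡ E x + D x
  D-suc x = pascal x (1 + p)

  B0≡0 : B 0 ≡ 0
  B0≡0 = k>n⇒nCk≡0 {0} {r} (s≤s z≤n)

  D0≡0 : D 0 ≡ 0
  D0≡0 = k>n⇒nCk≡0 {0} {2 + p} (s≤s z≤n)

  -- The largest number of r-subsets lying in single classes when x vertices are
  -- distributed over classes of size n: fill as many classes as possible.
  M : ℕ → ℕ
  M x = x / n * B n + B (x % n)

  /-unique : ∀ {t} u → t < n → (t + u * n) / n ≡ u
  /-unique {t} u t<n = begin
    (t + u * n) / n       ≡⟨ +-distrib-/-∣ʳ t (n∣m*n u) ⟩
    t / n + u * n / n     ≡⟨ cong₂ _+_ (m<n⇒m/n≡0 t<n) (m*n/n≡m u n) ⟩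
    u                     ∎
    where open ≡-Reasoning

  %-unique : ∀ {t} u → t < n → (t + u * n) % n ≡ t
  %-unique {t} u t<n = trans ([m+kn]%n≡m%n t u n) (m<n⇒m%n≡m t<n)

  M-unique : ∀ {t} u → t < n → M (t + u * n) ≡ u * B n + B t
  M-unique u t<n = cong₂ (λ a b → a * B n + B b) (/-unique u t<n) (%-unique u t<n)

  -- A new vertex creates `D x` new `r`-subsets, of which `D (x % n)` lie in the class being filled
  -- greedily; the others count towards `h`. Summing these increments defines `h` without a
  -- truncated `B x ∸ M x`, and `M+h≡B` recovers the difference.
  δ : ℕ → ℕ
  δ x = D x ∸ D (x % n)

  h : ℕ → ℕ
  h zero    = 0
  h (suc x) = h x + δ x

  data DivisionView : ℕ → Set where
    division : ∀ t u → t < n → DivisionView (t + u * n)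

  view : ∀ x → DivisionView x
  view x = subst DivisionView (sym (m≡m%n+[m/n]*n x n)) (division (x % n) (x / n) (m%n<n x n))

  M-suc : ∀ x → M (suc x) ≡ M x + D (x % n)
  M-suc x with view x
  ... | division t u t<n with m≤n⇒m<n∨m≡n t<n
  ...   | inj₁ 1+t<n = begin
    M (suc t + u * n)            ≡⟨ M-unique u 1+t<n ⟩
    u * B n + B (suc t)          ≡⟨ cong (u * B n +_) (trans (B-suc t) (+-comm (D t) (B t))) ⟩
    u * B n + (B t + D t)        ≡⟨ +-assoc (u * B n) (B t) (D t) ⟨
    u * B n + B t + D t          ≡⟨ cong₂ (λ a b → a + D b) (M-unique u t<n) (%-unique u t<n) ⟨
    M (t + u * n) + D ((t + u * n) % n) ∎
    where open ≡-Reasoning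
  -- The new vertex completes a class: the partial term becomes one more `B n`, and the remainder
  -- restarts at 0 with `B 0` equal to 0.
  ...   | inj₂ 1+t≡n = begin
    M (suc t + u * n)            ≡⟨ cong (λ a → M (a + u * n)) 1+t≡n ⟩
    M (suc u * n)                ≡⟨ M-unique (suc u) (≤-trans (s≤s z≤n) r≤n) ⟩
    B n + u * B n + B 0          ≡⟨ cong₂ (λ a b → a + u * B n + b) (trans (cong B (sym 1+t≡n)) (B-suc t)) B0≡0 ⟩
    D t + B t + u * B n + 0      ≡⟨ rearrange (D t) (B t) (u * B n) ⟩
    u * B n + B t + D t          ≡⟨ cong₂ (λ a b → a + D b) (M-unique u t<n) (%-unique u t<n) ⟨
    M (t + u * n) + D ((t + u * n) % n) ∎
    where
    open ≡-Reasoning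
    rearrange : ∀ a b c → a + b + c + 0 ≡ c + b + a
    rearrange = solve-∀

  M+h≡B : ∀ x → M x + h x ≡ B x
  M+h≡B zero    = trans (cong (_+ 0) (M-unique 0 (≤-trans (s≤s z≤n) r≤n))) (+-identityʳ (B 0))
    where
    _∙_ = trans
  M+h≡B (suc x) = begin
    M (suc x) + (h x + δ x)                ≡⟨ cong (_+ (h x + δ x)) (M-suc x) ⟩
    M x + D (x % n) + (h x + δ x)          ≡⟨ rearrange (M x) (D (x % n)) (h x) (δ x) ⟩
    D (x % n) + δ x + (M x + h x)          ≡⟨ cong₂ _+_ (m+[n∸m]≡n (C-monoˡ-≤ (2 + p) (m%n≤m x n))) (M+h≡B x) ⟩
    D x + B x                              ≡⟨ B-suc x ⟨
    B (suc x)                              ∎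
    where
    open ≡-Reasoning
    rearrange : ∀ a b c d → a + b + (c + d) ≡ b + d + (a + c)
    rearrange = solve-∀

  δ-unique : ∀ {t} u → t < n → δ (t + u * n) ≡ D (t + u * n) ∸ D t
  δ-unique {t} u t<n = cong (λ a → D (t + u * n) ∸ D a) (%-unique u t<n)

  δ-wrap : ∀ u → δ (u * n) ≡ D (u * n)
  δ-wrap u = trans (δ-unique u (≤-trans (s≤s z≤n) r≤n)) (cong (D (u * n) ∸_) D0≡0)

  E-≥ : ∀ x → n ≤ suc x → 0 < E x
  E-≥ x n≤1+x = C-positive (≤-trans (n≤1+n _) (s≤s⁻¹ (≤-trans r≤n n≤1+x)))

  -- Inside a class `δ` grows by `E X` minus `E t`, where `t` is the remainder of `X`; when a class
  -- is completed, the subtracted `D t` drops to 0. From `n - 1` on the growth is strict: either a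
  -- class is completed, or `t < X` because a full class lies behind.
  δ-mono-both : ∀ x → δ x ≤ δ (suc x) × (n ≤ suc x → δ x < δ (suc x))
  δ-mono-both x with view x
  ... | division t u t<n with m≤n⇒m<n∨m≡n t<n
  ...   | inj₁ 1+t<n = subst₂ _≤_ (sym δ₀) (sym δ₁) (∸-monoˡ-≤ (E t + D t) ≤₀) ,
                       λ n≤ → subst₂ _<_ (sym δ₀) (sym δ₁) (∸-monoˡ-< (<₀ n≤) (+-monoʳ-≤ (E t) (C-monoˡ-≤ (2 + p) (m≤m+n t (u * n)))))
    where
    X = t + u * n
    δ₀ : δ X ≡ (E t + D X) ∸ (E t + D t)
    -- Adding `E t` to both terms gives `δ X` and `δ (suc X)` the same subtrahend, so comparing them
    -- reduces to comparing `E t` with `E X`.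
    δ₀ = trans (δ-unique u t<n) (sym ([m+n]∸[m+o]≡n∸o (E t) (D X) (D t)))
    δ₁ : δ (suc X) ≡ (E X + D X) ∸ (E t + D t)
    δ₁ = trans (δ-unique u 1+t<n) (cong₂ _∸_ (D-suc X) (D-suc t))
    ≤₀ : E t + D X ≤ E X + D X
    ≤₀ = +-monoˡ-≤ (D X) (C-monoˡ-≤ (1 + p) (m≤m+n t (u * n)))
    <₀ : n ≤ suc X → E t + D X < E X + D X
    <₀ n≤1+X = +-monoˡ-< (D X) (C-monoˡ-< (s≤s⁻¹ (<-≤-trans 1+t<n n≤1+X))
      (≤-trans (n≤1+n (1 + p)) (s≤s⁻¹ (≤-trans r≤n n≤1+X))))
  ...   | inj₂ 1+t≡n = subst₂ _≤_ (sym (δ-unique u t<n)) (sym δ₁) (≤-trans (m∸n≤m (D X) (D t)) (m≤n+m (D X) (E X))) ,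
                       λ n≤ → subst₂ _<_ (sym (δ-unique u t<n)) (sym δ₁) (≤-<-trans (m∸n≤m (D X) (D t)) (m<n+m (D X) (E-≥ X n≤)))
    where
    X = t + u * n
    δ₁ : δ (suc X) ≡ E X + D X
    δ₁ = trans (cong (λ a → δ (a + u * n)) 1+t≡n) (trans (δ-wrap (suc u)) (trans (cong (λ a → D (a + u * n)) (sym 1+t≡n)) (D-suc X)))

  open Tangent h δ (λ _ → refl) (proj₁ ∘ δ-mono-both) public using (tangent; tangent-≡)

  -- All slopes below `n` are 0, so a tangent line there would touch a whole interval; `n ≤ m` keeps
  -- the tangent point out of this flat range.
  tangent-touches : ∀ m x → n ≤ m → h m + δ m * x ≡ h x + δ m * m → x ≡ m ⊎ x ≡ suc m
  tangent-touches zero    x n≤m eq = contradiction (≤-trans r≤n n≤m) λ ()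
  tangent-touches (suc y) x n≤m = tangent-≡ y x (proj₂ (δ-mono-both y) n≤m) (proj₂ (δ-mono-both (suc y)) (m≤n⇒m≤1+n n≤m))

  tangent-touches⁻¹ : ∀ m x → x ≡ m ⊎ x ≡ suc m → h m + δ m * x ≡ h x + δ m * m
  tangent-touches⁻¹ m x (inj₁ refl) = refl
  tangent-touches⁻¹ m x (inj₂ refl) = trans (cong (h m +_) (*-suc (δ m) m)) (sym (+-assoc (h m) (δ m) _))

  -- Let `t` be the size of the partly filled class. If `y` equals `n`, one full class is added; if
  -- `y + t < n`, the two parts merge without loss by superadditivity. Otherwise filling the class
  -- up and leaving a rest is strictly better by strict convexity. This last case is the one where
  -- the quotient grows although `y` is not a full class, so the quotient formula is needed only in
  -- the others.
  M-step : ∀ x y → y ≤ n →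
    B y + M x < M (y + x) ⊎ B y + M x ≤ M (y + x) × (y + x) / n ≡ ⟦ y ≟ n ⟧ + x / n
  M-step x y y≤n with view x
  ... | division t u t<n with m≤n⇒m<n∨m≡n y≤n
  ...   | inj₂ refl = inj₂ (≤-reflexive M-eq , quot-eq)
    where
    swap : ∀ n t z → n + (t + z) ≡ t + (n + z)
    swap = solve-∀
    quot-eq : (n + (t + u * n)) / n ≡ ⟦ n ≟ n ⟧ + (t + u * n) / n
    quot-eq = trans (cong (_/ n) (swap n t (u * n))) (trans (/-unique (suc u) t<n) (sym (cong₂ _+_ (⟦⟧-true (n ≟ n) refl) (/-unique u t<n))))
    M-eq : B n + M (t + u * n) ≡ M (n + (t + u * n))
    M-eq = sym (trans (cong M (swap n t (u * n))) (trans (M-unique (suc u) t<n) (trans (+-assoc (B n) _ _) (cong (B n +_) (sym (M-unique u t<n))))))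
  ...   | inj₁ y<n with y + t <? n
  ...     | yes y+t<n = inj₂ (M-≤ , quot-eq)
    where
    quot-eq : (y + (t + u * n)) / n ≡ ⟦ y ≟ n ⟧ + (t + u * n) / n
    quot-eq = trans (cong (_/ n) (sym (+-assoc y t (u * n)))) (trans (/-unique u y+t<n)
      (sym (cong₂ _+_ (⟦⟧-false (y ≟ n) (<⇒≢ y<n)) (/-unique u t<n))))
    superadditive : B y + B t ≤ B (y + t)
    superadditive = begin
      B y + B t              ≡⟨ cong (λ a → B a + B t) (+-identityʳ y) ⟨
      B (y + 0) + B t        ≤⟨ C-supermodular y r z≤n ⟩
      B (y + t) + B 0        ≡⟨ trans (cong (B (y + t) +_) B0≡0) (+-identityʳ _) ⟩
      B (y + t)              ∎
      where open ≤-Reasoning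
    M-≤ : B y + M (t + u * n) ≤ M (y + (t + u * n))
    M-≤ = begin
      B y + M (t + u * n)            ≡⟨ cong (B y +_) (M-unique u t<n) ⟩
      B y + (u * B n + B t)          ≡⟨ rearrange (B y) (u * B n) (B t) ⟩
      u * B n + (B y + B t)          ≤⟨ +-monoʳ-≤ (u * B n) superadditive ⟩
      u * B n + B (y + t)            ≡⟨ M-unique u y+t<n ⟨
      M (y + t + u * n)              ≡⟨ cong M (+-assoc y t (u * n)) ⟩
      M (y + (t + u * n))            ∎
      where
      open ≤-Reasoning
      rearrange : ∀ a b c → a + (b + c) ≡ b + (a + c)
      rearrange = solve-∀
  -- The partly filled class has room for `suc d` vertices and `s` vertices overflow, so `y` is
  -- `suc d + s` and `n` is `suc d + t`. The exchange compares the same increment starting from `s`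
  -- and from `t`.
  ...     | no  y+t≮n with s , s+n≡y+t ← ≤⇒∃+ (≮⇒≥ y+t≮n) | d , d+t≡n ← ≤⇒∃+ t<n = inj₁ M-<
    where
    1+d+t≡n : suc d + t ≡ n
    1+d+t≡n = trans (sym (+-suc d t)) d+t≡n
    1+d+s≡y : suc d + s ≡ y
    1+d+s≡y = +-cancelʳ-≡ t _ _ (trans (rearrange d s t) (trans (cong (s +_) 1+d+t≡n) s+n≡y+t))
      where
      rearrange : ∀ d s t → suc d + s + t ≡ s + (suc d + t)
      rearrange = solve-∀
    s<t : s < t
    s<t = +-cancelˡ-< (suc d) s t (subst₂ _<_ (sym 1+d+s≡y) (sym 1+d+t≡n) y<n)
    s<n : s < n
    s<n = <-trans s<t t<n
    strict-exchange : B y + B t < B n + B s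
    strict-exchange = subst₂ (λ a b → B a + B t < B b + B s) 1+d+s≡y 1+d+t≡n
      (C-supermodular-< d (1 + p) s<t (s≤s⁻¹ (≤-trans r≤n (≤-reflexive (sym 1+d+t≡n)))))
    M-< : B y + M (t + u * n) < M (y + (t + u * n))
    M-< = begin-strict
      B y + M (t + u * n)            ≡⟨ cong (B y +_) (M-unique u t<n) ⟩
      B y + (u * B n + B t)          ≡⟨ rearrange (B y) (u * B n) (B t) ⟩
      u * B n + (B y + B t)          <⟨ +-monoʳ-< (u * B n) strict-exchange ⟩
      u * B n + (B n + B s)          ≡⟨ rearrange′ (u * B n) (B n) (B s) ⟩
      suc u * B n + B s              ≡⟨ M-unique (suc u) s<n ⟨
      M (s + suc u * n)              ≡⟨ cong M (trans (sym (+-assoc s n _)) (trans (cong (_+ u * n) s+n≡y+t) (+-assoc y t _))) ⟩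
      M (y + (t + u * n))            ∎
      where
      open ≤-Reasoning
      rearrange : ∀ a b c → a + (b + c) ≡ b + (a + c)
      rearrange = solve-∀
      rearrange′ : ∀ a b c → a + (b + c) ≡ b + a + c
      rearrange′ = solve-∀

  -- One strict step makes the whole bound strict. Equality therefore leaves only steps in which the
  -- quotient counts the full classes.
  column-bound : ∀ {k} (x : Fin k → ℕ) → (∀ i → x i ≤ n) →
    ∑[ i < k ] B (x i) < M (sum x) ⊎
    ∑[ i < k ] B (x i) ≤ M (sum x) × sum x / n ≡ ∑[ i < k ] ⟦ x i ≟ n ⟧
  column-bound {zero}  x x≤n = inj₂ (z≤n , 0/n≡0 n)
  column-bound {suc k} x x≤n with column-bound (x ∘ suc) (x≤n ∘ suc) | M-step (sum (x ∘ suc)) (x zero) (x≤n zero)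
  ... | inj₁ <₁        | inj₁ <₂        = inj₁ (<-trans (+-monoʳ-< (B (x zero)) <₁) <₂)
  ... | inj₁ <₁        | inj₂ (≤₂ , _)  = inj₁ (<-≤-trans (+-monoʳ-< (B (x zero)) <₁) ≤₂)
  ... | inj₂ (≤₁ , _)  | inj₁ <₂        = inj₁ (≤-<-trans (+-monoʳ-≤ (B (x zero)) ≤₁) <₂)
  ... | inj₂ (≤₁ , e₁) | inj₂ (≤₂ , e₂) = inj₂ (≤-trans (+-monoʳ-≤ (B (x zero)) ≤₁) ≤₂ , trans e₂ (cong (⟦ x zero ≟ n ⟧ +_) e₁))

-- Permutations from equal multiplicities

module _ {A : Set} (_≟ᴬ_ : DecidableEquality A) where

  #values : ∀ {k} → (Fin k → A) → A → ℕ
  #values {k} f a = ∑[ i < k ] ⟦ f i ≟ᴬ a ⟧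

  -- Equal multiplicities supply an index where `f` takes the value `g zero`; deleting both
  -- occurrences keeps the multiplicities equal.
  matching : ∀ {k} (f g : Fin k → A) → (∀ a → #values f a ≡ #values g a) →
    ∃[ π ] ∀ i → f (π ⟨$⟩ʳ i) ≡ g i
  matching {zero}  f g same = Permutation.id , λ ()
  matching {suc k} f g same with any? (λ j → f j ≟ᴬ g zero)
  ... | no  ∄j = contradiction (begin
    1                                                        ≤⟨ m≤m+n 1 _ ⟩
    1 + #values (g ∘ suc) (g zero)                           ≡⟨ cong (_+ #values (g ∘ suc) (g zero)) (⟦⟧-true (g zero ≟ᴬ g zero) refl) ⟨
    #values g (g zero)                                       ≡⟨ same (g zero) ⟨
    #values f (g zero)                                       ≡⟨ sum-cong-≗ (λ j → ⟦⟧-false (f j ≟ᴬ g zero) λ p → ∄j (j , p)) ⟩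
    ∑[ i < suc k ] 0                                         ≡⟨ sum-replicate-zero (suc k) ⟩
    0                                                        ∎) λ ()
    where open ≤-Reasoning
  ... | yes (j , fj≡g0) = insert zero j (proj₁ rest) , λ
    { zero    → fj≡g0
    ; (suc i) → trans (cong f (insert-punchIn zero j (proj₁ rest) i)) (proj₂ rest i)
    }
    where
    same′ : ∀ a → #values (removeAt f j) a ≡ #values (g ∘ suc) a
    same′ a = +-cancelˡ-≡ ⟦ g zero ≟ᴬ a ⟧ _ _ (begin
      ⟦ g zero ≟ᴬ a ⟧ + #values (removeAt f j) a   ≡⟨ cong (λ b → ⟦ b ≟ᴬ a ⟧ + #values (removeAt f j) a) fj≡g0 ⟨
      ⟦ f j ≟ᴬ a ⟧ + #values (removeAt f j) a      ≡⟨ sum-remove {i = j} (λ i → ⟦ f i ≟ᴬ a ⟧) ⟨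
      #values f a                                  ≡⟨ same a ⟩
      #values g a                                  ∎)
      where open ≡-Reasoning
    rest = matching (removeAt f j) (g ∘ suc) same′

-- Once only two consecutive values are possible, the sum fixes how often each occurs. Applied to
-- color totals, this yields the permutation of colors.
matching-two-valued : ∀ {k m} (f g : Fin k → ℕ) →
  (∀ i → f i ≡ m ⊎ f i ≡ suc m) → (∀ i → g i ≡ m ⊎ g i ≡ suc m) → sum f ≡ sum g →
  ∃[ π ] ∀ i → f (π ⟨$⟩ʳ i) ≡ g i
matching-two-valued {k} {m} f g f∈ g∈ f≡g = matching _≟_ f g same
  where
  TwoValued : (Fin k → ℕ) → Set
  TwoValued f = ∀ i → f i ≡ m ⊎ f i ≡ suc m

  upper : ∀ f → TwoValued f → sum f ≡ k * m + #values _≟_ f (suc m)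
  upper f f∈ = begin
    sum f                                       ≡⟨ sum-cong-≗ (λ i → pointwise (f i) (f∈ i)) ⟩
    ∑[ i < k ] (m + ⟦ f i ≟ suc m ⟧)            ≡⟨ ∑-distrib-+ (λ _ → m) (λ i → ⟦ f i ≟ suc m ⟧) ⟩
    ∑[ i < k ] m + #values _≟_ f (suc m)        ≡⟨ cong (_+ #values _≟_ f (suc m)) (sum-const k m) ⟩
    k * m + #values _≟_ f (suc m)               ∎
    where
    open ≡-Reasoning
    pointwise : ∀ x → x ≡ m ⊎ x ≡ suc m → x ≡ m + ⟦ x ≟ suc m ⟧
    pointwise x (inj₁ refl) = sym (trans (cong (m +_) (⟦⟧-false (m ≟ suc m) (1+n≢n ∘ sym))) (+-identityʳ m))
    pointwise x (inj₂ refl) = sym (trans (cong (m +_) (⟦⟧-true (suc m ≟ suc m) refl)) (+-comm m 1))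

  lower : ∀ f → TwoValued f → sum f + #values _≟_ f m ≡ k * suc m
  lower f f∈ = begin
    sum f + #values _≟_ f m                     ≡⟨ ∑-distrib-+ f (λ i → ⟦ f i ≟ m ⟧) ⟨
    ∑[ i < k ] (f i + ⟦ f i ≟ m ⟧)              ≡⟨ sum-cong-≗ (λ i → pointwise (f i) (f∈ i)) ⟩
    ∑[ i < k ] (suc m)                          ≡⟨ sum-const k (suc m) ⟩
    k * suc m                                   ∎
    where
    open ≡-Reasoning
    pointwise : ∀ x → x ≡ m ⊎ x ≡ suc m → x + ⟦ x ≟ m ⟧ ≡ suc m
    pointwise x (inj₁ refl) = trans (cong (m +_) (⟦⟧-true (m ≟ m) refl)) (+-comm m 1)
    pointwise x (inj₂ refl) = trans (cong (suc m +_) (⟦⟧-false (suc m ≟ m) 1+n≢n)) (+-identityʳ (suc m))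

  other : ∀ f → TwoValued f → ∀ a → a ≢ m → a ≢ suc m → #values _≟_ f a ≡ 0
  other f f∈ a a≢m a≢1+m = trans (sum-cong-≗ λ i → ⟦⟧-false (f i ≟ a) (pointwise (f∈ i))) (sum-replicate-zero k)
    where
    pointwise : ∀ {x} → x ≡ m ⊎ x ≡ suc m → x ≢ a
    pointwise (inj₁ refl) refl = a≢m refl
    pointwise (inj₂ refl) refl = a≢1+m refl

  same : ∀ a → #values _≟_ f a ≡ #values _≟_ g a
  same a with a ≟ m | a ≟ suc m
  ... | yes refl | _        = +-cancelˡ-≡ (sum f) _ _ (trans (lower f f∈) (sym (trans (cong (_+ #values _≟_ g m) f≡g) (lower g g∈))))
  ... | no _     | yes refl = +-cancelˡ-≡ (k * m) _ _ (trans (sym (upper f f∈)) (trans f≡g (upper g g∈)))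
  ... | no a≢m   | no a≢1+m = trans (other f f∈ a a≢m a≢1+m) (sym (other g g∈ a a≢m a≢1+m))

sum≡0⇒≡0 : ∀ {k} (f : Fin k → ℕ) → sum f ≡ 0 → ∀ i → f i ≡ 0
sum≡0⇒≡0 f f≡0 i = n≤0⇒n≡0 (≤-trans (sum-≥ f i) (≤-reflexive f≡0))

sum-full : ∀ {k n} (f : Fin k → ℕ) i j → sum f ≡ n → f i ≡ n → i ≢ j → f j ≡ 0
sum-full {suc k} {n} f i j f≡n fi≡n i≢j = trans (cong f (sym (Fin.punchIn-punchOut i≢j)))
  (sum≡0⇒≡0 (removeAt f i) (+-cancelˡ-≡ n _ _ (begin
    n + sum (removeAt f i)     ≡⟨ cong (_+ sum (removeAt f i)) fi≡n ⟨
    f i + sum (removeAt f i)   ≡⟨ sum-remove f ⟨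
    sum f                      ≡⟨ f≡n ⟩
    n                          ≡⟨ +-identityʳ n ⟨
    n + 0                      ∎)) (punchOut i≢j))
  where open ≡-Reasoning

sum-indicator : ∀ {k} (b f : Fin k → ℕ) i → sum b ≤ 1 → b i ≡ 1 → ∑[ j < k ] (b j * f j) ≡ f i
sum-indicator {suc k} b f i b≤1 bi≡1 = begin
  ∑[ j < suc k ] (b j * f j)                         ≡⟨ sum-remove {i = i} (λ j → b j * f j) ⟩
  b i * f i + ∑[ j < k ] (b′ j * removeAt f i j)     ≡⟨ cong₂ _+_ (trans (cong (_* f i) bi≡1) (*-identityˡ (f i))) zeros ⟩
  f i + 0                                            ≡⟨ +-identityʳ (f i) ⟩
  f i                                                ∎
  where
  open ≡-Reasoning
  b′ = removeAt b i
  b′≡0 : sum b′ ≡ 0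
  b′≡0 = n≤0⇒n≡0 (s≤s⁻¹ (≤-trans (≤-reflexive (trans (cong (_+ sum b′) (sym bi≡1)) (sym (sum-remove b)))) b≤1))
  zeros : ∑[ j < k ] (b′ j * removeAt f i j) ≡ 0
  zeros = trans (sum-cong-≗ λ j → cong (_* removeAt f i j) (sum≡0⇒≡0 b′ b′≡0 j)) (sum-replicate-zero k)

-- Color distributions with `q` full classes per color

module Rows (n q : ℕ) (0<n : 0 < n) where

  Row : Set
  Row = Color → ℕ

  fullColor : Row → Maybe Color
  fullColor x with any? (λ c → x c ≟ n)
  ... | yes (c , _) = just c
  ... | no  _       = nothing

  _≟ᶜ_ : DecidableEquality (Maybe Color)
  _≟ᶜ_ = ≡-dec Fin._≟_

  fullColor-sound : ∀ x c → fullColor x ≡ just c → x c ≡ n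
  fullColor-sound x c eq with any? (λ c → x c ≟ n)
  fullColor-sound x c refl | yes (.c , xc≡n) = xc≡n

  fullColor-complete : ∀ x c → sum x ≡ n → x c ≡ n → fullColor x ≡ just c
  fullColor-complete x c x≡n xc≡n with any? (λ c → x c ≟ n)
  ... | no  ∄c = contradiction (c , xc≡n) ∄c
  ... | yes (d , xd≡n) with d Fin.≟ c
  ...   | yes d≡c = cong just d≡c
  ...   | no  d≢c = contradiction (trans (sym xc≡n) (sum-full x d c x≡n xd≡n d≢c)) (>⇒≢ 0<n)

  ⟦fullColor⟧ : ∀ x c → sum x ≡ n → ⟦ fullColor x ≟ᶜ just c ⟧ ≡ ⟦ x c ≟ n ⟧
  ⟦fullColor⟧ x c x≡n = ⟦⟧-⇔ (fullColor x ≟ᶜ just c) (x c ≟ n) (fullColor-sound x c) (fullColor-complete x c x≡n)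

  partition : ∀ m → ⟦ m ≟ᶜ nothing ⟧ + ∑[ c < 3 ] ⟦ m ≟ᶜ just c ⟧ ≡ 1
  partition nothing      = refl
  partition (just red)   = refl
  partition (just blue)  = refl
  partition (just green) = refl

  -- This is all that the comparison of rows retains of a tight coloring, apart from its color
  -- totals.
  record Packed {k} (x : Fin k → Row) : Set where
    field
      row-sum : ∀ i → sum (x i) ≡ n
      #full   : ∀ c → ∑[ i < k ] ⟦ x i c ≟ n ⟧ ≡ q

    type : Fin k → Maybe Color
    type = fullColor ∘ x

    #just : ∀ c → #values _≟ᶜ_ type (just c) ≡ q
    #just c = trans (sum-cong-≗ λ i → ⟦fullColor⟧ (x i) c (row-sum i)) (#full c)

    #nothing : #values _≟ᶜ_ type nothing + 3 * q ≡ k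
    #nothing = begin
      #values _≟ᶜ_ type nothing + 3 * q                                    ≡⟨ cong (#values _≟ᶜ_ type nothing +_) (trans (∑-comm (λ i c → ⟦ type i ≟ᶜ just c ⟧)) (trans (sum-cong-≗ #just) (sum-const 3 q))) ⟨
      #values _≟ᶜ_ type nothing + ∑[ i < k ] ∑[ c < 3 ] ⟦ type i ≟ᶜ just c ⟧ ≡⟨ ∑-distrib-+ (λ i → ⟦ type i ≟ᶜ nothing ⟧) (λ i → ∑[ c < 3 ] ⟦ type i ≟ᶜ just c ⟧) ⟨
      ∑[ i < k ] (⟦ type i ≟ᶜ nothing ⟧ + ∑[ c < 3 ] ⟦ type i ≟ᶜ just c ⟧) ≡⟨ sum-cong-≗ (partition ∘ type) ⟩
      ∑[ i < k ] 1                                                         ≡⟨ sum-1 k ⟩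
      k                                                                    ∎
      where open ≡-Reasoning

    split : ∀ i c → x i c ≡ ⟦ x i c ≟ n ⟧ * n + ⟦ type i ≟ᶜ nothing ⟧ * x i c
    split i c = by-type (x i c ≟ n) (type i) refl
      where
      by-type : (d : Dec (x i c ≡ n)) → ∀ t → type i ≡ t → x i c ≡ ⟦ d ⟧ * n + ⟦ t ≟ᶜ nothing ⟧ * x i c
      by-type (yes xic≡n) nothing  eq with () ← trans (sym eq) (fullColor-complete (x i) c (row-sum i) xic≡n)
      by-type (yes xic≡n) (just _) eq = trans xic≡n (sym (trans (+-identityʳ (n + 0)) (+-identityʳ n)))
      by-type (no  xic≢n) nothing  eq = sym (+-identityʳ (x i c))
      by-type (no  xic≢n) (just d) eq = sum-full (x i) d c (row-sum i) xid≡n λ { refl → xic≢n xid≡n }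
        where
        xid≡n = fullColor-sound (x i) d eq

    -- Full classes use up `3 * q` of the `k` classes, so no second class is untyped. Column `c`
    -- thus consists of `q` full classes, zeros and this one entry, which the column total
    -- determines.
    untyped : k ≤ 1 + 3 * q → ∀ i → type i ≡ nothing → ∀ c → ∑[ j < k ] x j c ≡ q * n + x i c
    untyped k≤ i i-untyped c = begin
      ∑[ j < k ] x j c                                                    ≡⟨ sum-cong-≗ (λ j → split j c) ⟩
      ∑[ j < k ] (⟦ x j c ≟ n ⟧ * n + ⟦ type j ≟ᶜ nothing ⟧ * x j c)      ≡⟨ ∑-distrib-+ (λ j → ⟦ x j c ≟ n ⟧ * n) (λ j → ⟦ type j ≟ᶜ nothing ⟧ * x j c) ⟩
      ∑[ j < k ] (⟦ x j c ≟ n ⟧ * n) + ∑[ j < k ] (⟦ type j ≟ᶜ nothing ⟧ * x j c)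
        ≡⟨ cong₂ _+_ (trans (sym (*-distribʳ-sum n (λ j → ⟦ x j c ≟ n ⟧))) (cong (_* n) (#full c)))
                     (sum-indicator (λ j → ⟦ type j ≟ᶜ nothing ⟧) (λ j → x j c) i
                       (+-cancelʳ-≤ (3 * q) _ 1 (≤-trans (≤-reflexive #nothing) k≤))
                       (⟦⟧-true (type i ≟ᶜ nothing) i-untyped)) ⟩
      q * n + x i c                                                       ∎
      where open ≡-Reasoning

  -- The types occur equally often on both sides, so the classes can be matched by type. A typed row
  -- is fixed by its type, an untyped one by the column totals.
  matching-rows : ∀ {k} (x y : Fin k → Row) → Packed x → Packed y → k ≤ 1 + 3 * q →
    (∀ c → ∑[ i < k ] x i c ≡ ∑[ i < k ] y i c) → ∃[ π ] ∀ i c → x (π ⟨$⟩ʳ i) c ≡ y i c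
  matching-rows {k} x y packedˣ packedʸ k≤ columns = π , rows
    where
    module X = Packed packedˣ
    module Y = Packed packedʸ

    same : ∀ t → #values _≟ᶜ_ X.type t ≡ #values _≟ᶜ_ Y.type t
    same nothing  = +-cancelʳ-≡ (3 * q) _ _ (trans X.#nothing (sym Y.#nothing))
    same (just c) = trans (X.#just c) (sym (Y.#just c))

    matched = matching _≟ᶜ_ X.type Y.type same
    π = proj₁ matched

    rows : ∀ i c → x (π ⟨$⟩ʳ i) c ≡ y i c
    rows i c = by-type (Y.type i) refl (proj₂ matched i)
      where
      j = π ⟨$⟩ʳ i
      by-type : ∀ t → Y.type i ≡ t → X.type j ≡ Y.type i → x j c ≡ y i c
      by-type nothing  i-untyped same-type = +-cancelˡ-≡ (q * n) _ _
        (trans (sym (X.untyped k≤ j (trans same-type i-untyped) c)) (trans (columns c) (Y.untyped k≤ i i-untyped c)))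
      by-type (just d) i-typed same-type with d Fin.≟ c
      ... | yes refl = trans (fullColor-sound (x j) d (trans same-type i-typed)) (sym (fullColor-sound (y i) d i-typed))
      ... | no  d≢c  = trans (sum-full (x j) d c (X.row-sum j) (fullColor-sound (x j) d (trans same-type i-typed)) d≢c)
                             (sym (sum-full (y i) d c (Y.row-sum i) (fullColor-sound (y i) d i-typed) d≢c))

-- Monochromatic edges in terms of color counts

nonempty : ∀ {N s} (e : Subset N) → ∣ e ∣ ≡ suc s → Nonempty e
nonempty (inside ∷ e)  _  = zero , here
nonempty (outside ∷ e) eq = let v , v∈e = nonempty e eq in suc v , there v∈e

module Counting (k n s : ℕ) where

  open BalancedCompleteHypergraph k n (suc s)

  class-combine : ∀ i j → class (combine i j) ≡ i
  class-combine i j = cong proj₁ (Fin.remQuot-combine i j)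

  private
    cell? : ∀ (χ : Coloring) i c v → Dec (class v ≡ i × χ v ≡ c)
    cell? χ i c v = (class v Fin.≟ i) ×-dec (χ v Fin.≟ c)

  #colored-∑ : ∀ χ i c → #colored χ i c ≡ ∑[ v < k * n ] ⟦ cell? χ i c v ⟧
  #colored-∑ χ i c = trans (length-filter (cell? χ i c) (allFin (k * n))) (total-tabulate (λ v → ⟦ cell? χ i c v ⟧) id)

  #colored-combine : ∀ χ i c → #colored χ i c ≡ ∑[ j < n ] ⟦ χ (combine i j) Fin.≟ c ⟧
  #colored-combine χ i c = begin
    #colored χ i c                                                  ≡⟨ #colored-∑ χ i c ⟩
    ∑[ v < k * n ] ⟦ cell? χ i c v ⟧                                ≡⟨ sum-combine k n _ ⟩
    ∑[ a < k ] ∑[ j < n ] ⟦ cell? χ i c (combine a j) ⟧             ≡⟨ ∑-comm {k} {n} (λ a j → ⟦ cell? χ i c (combine a j) ⟧) ⟩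
    ∑[ j < n ] ∑[ a < k ] ⟦ cell? χ i c (combine a j) ⟧             ≡⟨ sum-cong-≗ pointwise ⟩
    ∑[ j < n ] ⟦ χ (combine i j) Fin.≟ c ⟧                          ∎
    where
    open ≡-Reasoning
    pointwise : ∀ j → ∑[ a < k ] ⟦ cell? χ i c (combine a j) ⟧ ≡ ⟦ χ (combine i j) Fin.≟ c ⟧
    pointwise j = sum-⟦⟧-unique (λ a → cell? χ i c (combine a j)) (χ (combine i j) Fin.≟ c)
      (λ a b (a∈i , _) (b∈i , _) → trans (sym (class-combine a j)) (trans a∈i (trans (sym b∈i) (class-combine b j))))
      (λ a (a∈i , q) → trans (cong (λ b → χ (combine b j)) (trans (sym a∈i) (class-combine a j))) q)
      (λ q → i , class-combine i j , q)

  row-sum : ∀ χ i → ∑[ c < 3 ] #colored χ i c ≡ n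
  row-sum χ i = begin
    ∑[ c < 3 ] #colored χ i c                                ≡⟨ sum-cong-≗ (#colored-combine χ i) ⟩
    ∑[ c < 3 ] ∑[ j < n ] ⟦ χ (combine i j) Fin.≟ c ⟧        ≡⟨ ∑-comm (λ c j → ⟦ χ (combine i j) Fin.≟ c ⟧) ⟩
    ∑[ j < n ] ∑[ c < 3 ] ⟦ χ (combine i j) Fin.≟ c ⟧        ≡⟨ sum-cong-≗ (λ j → one-color (χ (combine i j))) ⟩
    ∑[ j < n ] 1                                             ≡⟨ sum-1 n ⟩
    n                                                        ∎
    where
    open ≡-Reasoning
    one-color : ∀ d → ∑[ c < 3 ] ⟦ d Fin.≟ c ⟧ ≡ 1
    one-color red   = refl
    one-color blue  = refl
    one-color green = refl

  colorTotal : Coloring → Color → ℕ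
  colorTotal χ c = ∑[ i < k ] #colored χ i c

  colorTotal-∑ : ∀ χ c → colorTotal χ c ≡ ∑[ v < k * n ] ⟦ χ v Fin.≟ c ⟧
  colorTotal-∑ χ c = trans (sum-cong-≗ λ i → #colored-combine χ i c) (sym (sum-combine k n (λ v → ⟦ χ v Fin.≟ c ⟧)))

  ∑-colorTotal : ∀ χ → ∑[ c < 3 ] colorTotal χ c ≡ k * n
  ∑-colorTotal χ = trans (∑-comm (λ c i → #colored χ i c)) (trans (sum-cong-≗ (row-sum χ)) (sum-const k n))

  #colored-≤ : ∀ χ i c → #colored χ i c ≤ n
  #colored-≤ χ i c = ≤-trans (sum-≥ (#colored χ i) c) (≤-reflexive (row-sum χ i))

  -- Among the r-subsets of single colors, the edges are those not inside a class.
  #monochromatic-formula : ∀ χ →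
    #monochromatic χ + ∑[ i < k ] ∑[ c < 3 ] (#colored χ i c C suc s) ≡ ∑[ c < 3 ] (colorTotal χ c C suc s)
  #monochromatic-formula χ = begin
    #monochromatic χ + ∑[ i < k ] ∑[ c < 3 ] (#colored χ i c C suc s)
      ≡⟨ cong₂ _+_ (length-filter-filter isEdge? (monochromatic? χ) es) (sum-cong-≗ λ i → sum-cong-≗ λ c → cell-count i c) ⟩
    total monoEdge es + ∑[ i < k ] ∑[ c < 3 ] total (inCell i c) es
      ≡⟨ cong (total monoEdge es +_) (trans (total-∑ (λ i e → ∑[ c < 3 ] inCell i c e) es) (sum-cong-≗ λ i → total-∑ (inCell i) es)) ⟨
    total monoEdge es + total (λ e → ∑[ i < k ] ∑[ c < 3 ] inCell i c e) es
      ≡⟨ total-+ monoEdge (λ e → ∑[ i < k ] ∑[ c < 3 ] inCell i c e) es ⟨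
    total (λ e → monoEdge e + ∑[ i < k ] ∑[ c < 3 ] inCell i c e) es
      ≡⟨ total-cong pointwise es ⟩
    total (λ e → ∑[ c < 3 ] inColor c e) es
      ≡⟨ total-∑ inColor es ⟩
    ∑[ c < 3 ] total (inColor c) es
      ≡⟨ sum-cong-≗ (λ c → trans (count-subsets (k * n) (suc s) (λ v → χ v Fin.≟ c)) (cong (_C suc s) (sym (colorTotal-∑ χ c)))) ⟩
    ∑[ c < 3 ] (colorTotal χ c C suc s) ∎
    where
    open ≡-Reasoning
    es = subsets (k * n)

    inCell? : ∀ i c e → Dec (∣ e ∣ ≡ suc s × Within (λ v → class v ≡ i × χ v ≡ c) e)
    inCell? i c e = (∣ e ∣ ≟ suc s) ×-dec within? (cell? χ i c) e
    inColor? : ∀ c e → Dec (∣ e ∣ ≡ suc s × Within (λ v → χ v ≡ c) e)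
    inColor? c e = (∣ e ∣ ≟ suc s) ×-dec within? (λ v → χ v Fin.≟ c) e
    monoEdge? : ∀ e → Dec (IsEdge e × Monochromatic χ e)
    monoEdge? e = isEdge? e ×-dec monochromatic? χ e

    inCell : Fin k → Color → Subset (k * n) → ℕ
    inCell i c e = ⟦ inCell? i c e ⟧
    inColor : Color → Subset (k * n) → ℕ
    inColor c e = ⟦ inColor? c e ⟧
    monoEdge : Subset (k * n) → ℕ
    monoEdge e = ⟦ monoEdge? e ⟧

    cell-count : ∀ i c → #colored χ i c C suc s ≡ total (inCell i c) es
    cell-count i c = trans (cong (_C suc s) (#colored-∑ χ i c)) (sym (count-subsets (k * n) (suc s) (cell? χ i c)))

    pointwise : ∀ e → monoEdge e + ∑[ i < k ] ∑[ c < 3 ] inCell i c e ≡ ∑[ c < 3 ] inColor c e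
    pointwise e = begin
      monoEdge e + ∑[ i < k ] ∑[ c < 3 ] inCell i c e   ≡⟨ cong (monoEdge e +_) cells ⟩
      monoEdge e + ⟦ anyCell? ⟧                          ≡⟨ disjoint anyCell? ⟩
      ⟦ anyColor? ⟧                                      ≡⟨ colors ⟨
      ∑[ c < 3 ] inColor c e                             ∎
      where
      anyCellOf? : ∀ i → Dec (∃ λ c → ∣ e ∣ ≡ suc s × Within (λ v → class v ≡ i × χ v ≡ c) e)
      anyCellOf? i = any? λ c → inCell? i c e
      anyCell? = any? anyCellOf?
      anyColor? = any? λ c → inColor? c e

      -- Positive uniformity enters here: a nonempty set has at most one color and lies in at most
      -- one class.
      unique : ∀ {I : Set} (f : Fin (k * n) → I) {a b : I} → ∣ e ∣ ≡ suc s →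
        (∀ v → v ∈ e → f v ≡ a) → (∀ v → v ∈ e → f v ≡ b) → a ≡ b
      unique f size fa fb = let v , v∈e = nonempty e size in trans (sym (fa v v∈e)) (fb v v∈e)

      colors : ∑[ c < 3 ] inColor c e ≡ ⟦ anyColor? ⟧
      colors = sum-⟦⟧-unique (λ c → inColor? c e) anyColor?
        (λ c d (size , wc) (_ , wd) → unique χ size wc wd) (λ c w → c , w) id

      cells : ∑[ i < k ] ∑[ c < 3 ] inCell i c e ≡ ⟦ anyCell? ⟧
      cells = trans
        (sum-cong-≗ λ i → sum-⟦⟧-unique (λ c → inCell? i c e) (anyCellOf? i)
          (λ c d (size , wc) (_ , wd) → unique χ size (λ v v∈e → proj₂ (wc v v∈e)) (λ v v∈e → proj₂ (wd v v∈e)))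
          (λ c w → c , w) id)
        (sum-⟦⟧-unique anyCellOf? anyCell?
          (λ i j (_ , size , wi) (_ , _ , wj) → unique class size (λ v v∈e → proj₁ (wi v v∈e)) (λ v v∈e → proj₁ (wj v v∈e)))
          (λ i w → i , w) id)

      -- A one-colored `r`-subset either lies in a class, hence in one cell of a class and a color,
      -- or is a monochromatic edge, and never both.
      disjoint : (d : Dec (∃ λ i → ∃ λ c → ∣ e ∣ ≡ suc s × Within (λ v → class v ≡ i × χ v ≡ c) e)) →
        monoEdge e + ⟦ d ⟧ ≡ ⟦ anyColor? ⟧
      disjoint (yes (i , c , size , w)) = trans
        (cong (_+ 1) (⟦⟧-false (monoEdge? e) λ ((_ , ¬contained) , _) → ¬contained (i , λ v v∈e → proj₁ (w v v∈e))))
        (sym (⟦⟧-true anyColor? (c , size , λ v v∈e → proj₂ (w v v∈e))))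
      disjoint (no ∄cell) = trans (+-identityʳ (monoEdge e)) (⟦⟧-⇔ (monoEdge? e) anyColor?
        (λ ((size , _) , c , w) → c , size , w)
        (λ (c , size , w) → (size , λ (i , wi) → ∄cell (i , c , size , λ v v∈e → wi v v∈e , w v v∈e)) , c , w))

-- The lower bound and its equality case

module Extremal (k n p m : ℕ) (r≤n : 3 + p ≤ n) (n≤m : n ≤ m) .{{_ : NonZero n}} where

  open BalancedCompleteHypergraph k n (3 + p)
  open Counting k n (2 + p)
  open Packing n p r≤n

  contained : Coloring → Color → ℕ
  contained χ c = ∑[ i < k ] B (#colored χ i c)

  -- These are the two sides of the greedy bound and the tangent bound added together, with `M` and
  -- `h` recombined into `B`. Summed over the colors, `contained` cancels and a bound on
  -- `#monochromatic` independent of the coloring remains.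
  lower upper : Coloring → Color → ℕ
  lower χ c = contained χ c + (h m + δ m * colorTotal χ c)
  upper χ c = B (colorTotal χ c) + δ m * m

  upper-split : ∀ χ c → upper χ c ≡ M (colorTotal χ c) + (h (colorTotal χ c) + δ m * m)
  upper-split χ c = trans (cong (_+ δ m * m) (sym (M+h≡B (colorTotal χ c)))) (+-assoc (M (colorTotal χ c)) _ _)

  lower≤upper : ∀ χ c → lower χ c ≤ upper χ c
  lower≤upper χ c = ≤-trans (+-mono-≤ contained≤M (tangent m (colorTotal χ c))) (≤-reflexive (sym (upper-split χ c)))
    where
    contained≤M : contained χ c ≤ M (colorTotal χ c)
    contained≤M with column-bound (λ i → #colored χ i c) (λ i → #colored-≤ χ i c)
    ... | inj₁ <M       = <⇒≤ <M
    ... | inj₂ (≤M , _) = ≤M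

  ∑-lower : ∀ χ → ∑[ c < 3 ] lower χ c ≡ ∑[ c < 3 ] contained χ c + (3 * h m + δ m * (k * n))
  ∑-lower χ = begin
    ∑[ c < 3 ] lower χ c
      ≡⟨ ∑-distrib-+ (contained χ) (λ c → h m + δ m * colorTotal χ c) ⟩
    ∑[ c < 3 ] contained χ c + ∑[ c < 3 ] (h m + δ m * colorTotal χ c)
      ≡⟨ cong (∑[ c < 3 ] contained χ c +_) (trans (∑-distrib-+ (λ (c : Color) → h m) (λ c → δ m * colorTotal χ c))
           (cong₂ _+_ (sum-const 3 (h m)) (trans (sym (*-distribˡ-sum (δ m) (colorTotal χ))) (cong (δ m *_) (∑-colorTotal χ))))) ⟩
    ∑[ c < 3 ] contained χ c + (3 * h m + δ m * (k * n)) ∎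
    where open ≡-Reasoning

  ∑-upper : ∀ χ → ∑[ c < 3 ] upper χ c ≡ ∑[ c < 3 ] contained χ c + (#monochromatic χ + 3 * (δ m * m))
  ∑-upper χ = begin
    ∑[ c < 3 ] upper χ c
      ≡⟨ ∑-distrib-+ (B ∘ colorTotal χ) (λ c → δ m * m) ⟩
    ∑[ c < 3 ] B (colorTotal χ c) + ∑[ c < 3 ] (δ m * m)
      ≡⟨ cong₂ _+_ (sym (#monochromatic-formula χ)) (sum-const 3 (δ m * m)) ⟩
    #monochromatic χ + ∑[ i < k ] ∑[ c < 3 ] B (#colored χ i c) + 3 * (δ m * m)
      ≡⟨ cong (λ a → #monochromatic χ + a + 3 * (δ m * m)) (∑-comm (λ i c → B (#colored χ i c))) ⟩
    #monochromatic χ + ∑[ c < 3 ] contained χ c + 3 * (δ m * m)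
      ≡⟨ rearrange (#monochromatic χ) (∑[ c < 3 ] contained χ c) (3 * (δ m * m)) ⟩
    ∑[ c < 3 ] contained χ c + (#monochromatic χ + 3 * (δ m * m)) ∎
    where
    open ≡-Reasoning
    rearrange : ∀ a b c → a + b + c ≡ b + (a + c)
    rearrange = solve-∀

  Tight : Coloring → Set
  Tight χ = ∀ c → lower χ c ≡ upper χ c

  bound : ∀ χ → 3 * h m + δ m * (k * n) ≤ #monochromatic χ + 3 * (δ m * m)
  bound χ = +-cancelˡ-≤ (∑[ c < 3 ] contained χ c) _ _
    (subst₂ _≤_ (∑-lower χ) (∑-upper χ) (sum-mono (lower≤upper χ)))

  tight⇒bound-attained : ∀ χ → Tight χ → #monochromatic χ + 3 * (δ m * m) ≡ 3 * h m + δ m * (k * n)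
  tight⇒bound-attained χ tight = +-cancelˡ-≡ (∑[ c < 3 ] contained χ c) _ _
    (trans (sym (∑-upper χ)) (trans (sym (sum-cong-≗ tight)) (∑-lower χ)))

  tight⇒minimizing : ∀ χ → Tight χ → Minimizing χ
  tight⇒minimizing χ tight χ′ = +-cancelʳ-≤ (3 * (δ m * m)) _ _
    (≤-trans (≤-reflexive (tight⇒bound-attained χ tight)) (bound χ′))

  minimizing⇒tight : ∀ χ χ′ → Tight χ → Minimizing χ′ → Tight χ′
  minimizing⇒tight χ χ′ tight minimizing = sum-mono-≡ (lower≤upper χ′)
    (subst₂ _≤_ (sym (∑-upper χ′)) (sym (∑-lower χ′)) (+-monoʳ-≤ (∑[ c < 3 ] contained χ′ c)
      (≤-trans (+-monoˡ-≤ (3 * (δ m * m)) (minimizing χ)) (≤-reflexive (tight⇒bound-attained χ tight)))))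

  -- Tightness is equality in a sum of two inequalities and forces both: the tangent bound gives the
  -- totals, and the greedy bound rules out the strict alternative of `column-bound`.
  tight⇒shape : ∀ χ → Tight χ → ∀ c →
    (colorTotal χ c ≡ m ⊎ colorTotal χ c ≡ suc m) ×
    colorTotal χ c / n ≡ ∑[ i < k ] ⟦ #colored χ i c ≟ n ⟧
  tight⇒shape χ tight c with column-bound (λ i → #colored χ i c) (λ i → #colored-≤ χ i c)
  ... | inj₁ <M = contradiction (trans (tight c) (upper-split χ c)) (<⇒≢ (+-mono-<-≤ <M (tangent m (colorTotal χ c))))
  ... | inj₂ (≤M , quot) = tangent-touches m X n≤m (≤-antisym (tangent m X) touches) , quot
    where
    X = colorTotal χ c
    touches : h X + δ m * m ≤ h m + δ m * X
    touches = +-cancelˡ-≤ (M X) _ _ (≤-trans (≤-reflexive (sym (trans (tight c) (upper-split χ c)))) (+-monoˡ-≤ (h m + δ m * X) ≤M))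

  shape⇒tight : ∀ χ → (∀ c → contained χ c ≡ M (colorTotal χ c)) →
    (∀ c → colorTotal χ c ≡ m ⊎ colorTotal χ c ≡ suc m) → Tight χ
  shape⇒tight χ packed balanced c =
    trans (cong₂ _+_ (packed c) (tangent-touches⁻¹ m (colorTotal χ c) (balanced c))) (sym (upper-split χ c))

  module _ (q w : ℕ) (m≡ : m ≡ w + q * n) (1+w<n : suc w < n) (k≤ : k ≤ 1 + 3 * q) where

    open Rows n q (≤-trans (s≤s z≤n) r≤n)

    -- Because `suc w < n`, passing from `m` to `m + 1` completes no class, so both admissible
    -- totals have quotient `q`.
    tight⇒packed : ∀ χ → Tight χ → ∀ c → ∑[ i < k ] ⟦ #colored χ i c ≟ n ⟧ ≡ q
    tight⇒packed χ tight c with tight⇒shape χ tight c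
    ... | inj₁ X≡m   , quot = trans (sym quot) (trans (cong (_/ n) (trans X≡m m≡)) (/-unique q (<-trans (n<1+n w) 1+w<n)))
    ... | inj₂ X≡1+m , quot = trans (sym quot) (trans (cong (_/ n) (trans X≡1+m (cong suc m≡))) (/-unique q 1+w<n))

    -- The colors have to be aligned before the classes: only after applying `σ` do the column
    -- totals agree, as `matching-rows` requires.
    tight⇒≈ : ∀ χ χ′ → Tight χ → Tight χ′ → χ ≈ χ′
    tight⇒≈ χ χ′ tight tight′ = proj₁ rows , σ , proj₂ rows
      where
      totals = matching-two-valued (colorTotal χ) (colorTotal χ′)
        (proj₁ ∘ tight⇒shape χ tight) (proj₁ ∘ tight⇒shape χ′ tight′)
        (trans (∑-colorTotal χ) (sym (∑-colorTotal χ′)))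
      σ = proj₁ totals
      rows = matching-rows (λ i c → #colored χ i (σ ⟨$⟩ʳ c)) (#colored χ′)
        (record { row-sum = λ i → trans (sym (sum-permute (#colored χ i) σ)) (row-sum χ i)
                ; #full   = λ c → tight⇒packed χ tight (σ ⟨$⟩ʳ c) })
        (record { row-sum = row-sum χ′ ; #full = tight⇒packed χ′ tight′ })
        k≤ (proj₂ totals)

    tight⇒unique-minimizer : ∀ χ → Tight χ → Minimizing χ × (∀ χ′ → Minimizing χ′ → χ′ ≈ χ)
    tight⇒unique-minimizer χ tight = tight⇒minimizing χ tight ,
      λ χ′ minimizing → tight⇒≈ χ′ χ (minimizing⇒tight χ χ′ tight minimizing) tight

-- Balanced rows, blocks of classes and cyclic colorings

argmin : ∀ {k} (f : Fin (suc k) → ℕ) → ∃[ i ] ∀ j → f i ≤ f j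
argmin {zero}  f = zero , λ { zero → ≤-refl }
argmin {suc k} f with i , f[i]≤ ← argmin (f ∘ suc) with ≤-total (f zero) (f (suc i))
... | inj₁ 0≤i = zero  , λ { zero → ≤-refl ; (suc j) → ≤-trans 0≤i (f[i]≤ j) }
... | inj₂ i≤0 = suc i , λ { zero → i≤0    ; (suc j) → f[i]≤ j }

-- Take `w` to be the smallest entry. Then `3 * w ≤ n`, which together with `3 ≤ n` leaves room for
-- `suc w < n`.
balanced⇒two-valued : ∀ {n} (y : Color → ℕ) → sum y ≡ n → 3 ≤ n → (∀ c d → y c ≤ y d + 1) →
  ∃[ w ] suc w < n × (∀ c → y c ≡ w ⊎ y c ≡ suc w)
balanced⇒two-valued {n} y y≡n 3≤n balanced = w , small w 3w≤n , two-valued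
  where
  smallest = argmin y
  w = y (proj₁ smallest)

  two-valued : ∀ c → y c ≡ w ⊎ y c ≡ suc w
  two-valued c with m≤n⇒m<n∨m≡n (proj₂ smallest c)
  ... | inj₁ w<y = inj₂ (≤-antisym (≤-trans (balanced c (proj₁ smallest)) (≤-reflexive (+-comm w 1))) w<y)
  ... | inj₂ w≡y = inj₁ (sym w≡y)

  3w≤n : 3 * w ≤ n
  3w≤n = ≤-trans (≤-reflexive (sym (sum-const 3 w))) (≤-trans (sum-mono (proj₂ smallest)) (≤-reflexive y≡n))

  small : ∀ w → 3 * w ≤ n → suc w < n
  small zero    _    = ≤-trans (s≤s (s≤s z≤n)) 3≤n
  small (suc w) 3w≤n = ≤-trans (≤-trans (m≤m+n (3 + w) (w + w)) (≤-reflexive (rearrange w))) 3w≤n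
    where
    rearrange : ∀ w → 3 + w + (w + w) ≡ 3 * suc w
    rearrange = solve-∀

-- ℓ lists the rows after the three blocks.
sum-blocks : ∀ {k} q e → k ≡ q + (q + (q + e)) →
  Σ[ ℓ ∈ (Fin e → Fin k) ] (∀ j → toℕ (ℓ j) ≡ 3 * q + toℕ j) ×
    (∀ (f : Fin k → ℕ) a b c →
      (∀ i → toℕ i < q → f i ≡ a) →
      (∀ i → q ≤ toℕ i → toℕ i < 2 * q → f i ≡ b) →
      (∀ i → 2 * q ≤ toℕ i → toℕ i < 3 * q → f i ≡ c) →
      sum f ≡ q * a + (q * b + (q * c + ∑[ j < e ] f (ℓ j))))
sum-blocks {k} q e refl = ℓ , toℕ-ℓ , sum-split
  where
  ℓ : Fin e → Fin k
  ℓ j = q ↑ʳ (q ↑ʳ (q ↑ʳ j))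

  toℕ-2 : ∀ {o} (i : Fin o) → toℕ (q ↑ʳ (q ↑ʳ i)) ≡ 2 * q + toℕ i
  toℕ-2 i = trans (Fin.toℕ-↑ʳ q _) (trans (cong (q +_) (Fin.toℕ-↑ʳ q i)) (rearrange q (toℕ i)))
    where
    rearrange : ∀ q i → q + (q + i) ≡ 2 * q + i
    rearrange = solve-∀

  toℕ-ℓ : ∀ j → toℕ (ℓ j) ≡ 3 * q + toℕ j
  toℕ-ℓ j = trans (toℕ-2 (q ↑ʳ j)) (trans (cong (2 * q +_) (Fin.toℕ-↑ʳ q j)) (rearrange q (toℕ j)))
    where
    rearrange : ∀ q j → 2 * q + (q + j) ≡ 3 * q + j
    rearrange = solve-∀

  block : ∀ {a} (f : Fin q → ℕ) → (∀ i → f i ≡ a) → sum f ≡ q * a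
  block {a} f f≡a = trans (sum-cong-≗ f≡a) (sum-const q a)

  module _ (f : Fin k → ℕ) a b c
    (f₁ : ∀ i → toℕ i < q → f i ≡ a)
    (f₂ : ∀ i → q ≤ toℕ i → toℕ i < 2 * q → f i ≡ b)
    (f₃ : ∀ i → 2 * q ≤ toℕ i → toℕ i < 3 * q → f i ≡ c) where

    block₁ : ∀ i → f (i ↑ˡ (q + (q + e))) ≡ a
    block₁ i = f₁ _ (≤-<-trans (≤-reflexive (Fin.toℕ-↑ˡ i _)) (Fin.toℕ<n i))

    block₂ : ∀ i → f (q ↑ʳ (i ↑ˡ (q + e))) ≡ b
    block₂ i = f₂ _ (≤-trans (m≤m+n q _) (≤-reflexive (sym eq)))
      (≤-<-trans (≤-reflexive eq) (+-monoʳ-< q (<-≤-trans (Fin.toℕ<n i) (m≤m+n q 0))))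
      where
      eq : toℕ (q ↑ʳ (i ↑ˡ (q + e))) ≡ q + toℕ i
      eq = trans (Fin.toℕ-↑ʳ q _) (cong (q +_) (Fin.toℕ-↑ˡ i _))

    block₃ : ∀ i → f (q ↑ʳ (q ↑ʳ (i ↑ˡ e))) ≡ c
    block₃ i = f₃ _ (≤-trans (m≤m+n (2 * q) _) (≤-reflexive (sym eq)))
      (≤-<-trans (≤-reflexive eq) (<-≤-trans (+-monoʳ-< (2 * q) (Fin.toℕ<n i)) (≤-reflexive (+-comm (2 * q) q))))
      where
      eq : toℕ (q ↑ʳ (q ↑ʳ (i ↑ˡ e))) ≡ 2 * q + toℕ i
      eq = trans (toℕ-2 _) (cong (2 * q +_) (Fin.toℕ-↑ˡ i e))

    sum-split : sum f ≡ q * a + (q * b + (q * c + ∑[ j < e ] f (ℓ j)))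
    sum-split = begin
      sum f
        ≡⟨ sum-+ q (q + (q + e)) f ⟩
      ∑[ i < q ] f (i ↑ˡ (q + (q + e))) + ∑[ i < q + (q + e) ] f (q ↑ʳ i)
        ≡⟨ cong₂ _+_ (block _ block₁) (sum-+ q (q + e) (λ i → f (q ↑ʳ i))) ⟩
      q * a + (∑[ i < q ] f (q ↑ʳ (i ↑ˡ (q + e))) + ∑[ i < q + e ] f (q ↑ʳ (q ↑ʳ i)))
        ≡⟨ cong (q * a +_) (cong₂ _+_ (block _ block₂) (sum-+ q e (λ i → f (q ↑ʳ (q ↑ʳ i))))) ⟩
      q * a + (q * b + (∑[ i < q ] f (q ↑ʳ (q ↑ʳ (i ↑ˡ e))) + ∑[ j < e ] f (ℓ j)))
        ≡⟨ cong (λ x → q * a + (q * b + (x + ∑[ j < e ] f (ℓ j)))) (block _ block₃) ⟩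
      q * a + (q * b + (q * c + ∑[ j < e ] f (ℓ j))) ∎
      where open ≡-Reasoning

-- Repeating the colors with period three witnesses that a balanced last class exists.
cyclic : ∀ n → Fin n → Color
cyclic (suc zero)          _                   = red
cyclic (suc (suc zero))    zero                = red
cyclic (suc (suc zero))    (suc _)             = blue
cyclic (suc (suc (suc n))) zero                = red
cyclic (suc (suc (suc n))) (suc zero)          = blue
cyclic (suc (suc (suc n))) (suc (suc zero))    = green
cyclic (suc (suc (suc n))) (suc (suc (suc j))) = cyclic n j

cyclic-balanced : ∀ n c d → #values Fin._≟_ (cyclic n) c ≤ #values Fin._≟_ (cyclic n) d + 1
cyclic-balanced zero             c d = z≤n
cyclic-balanced (suc zero)       c d = ≤-trans (at-most-one c) (m≤n+m 1 _)
  where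
  at-most-one : ∀ c → #values Fin._≟_ (cyclic 1) c ≤ 1
  at-most-one red   = s≤s z≤n
  at-most-one blue  = z≤n
  at-most-one green = z≤n
cyclic-balanced (suc (suc zero)) c d = ≤-trans (at-most-one c) (m≤n+m 1 _)
  where
  at-most-one : ∀ c → #values Fin._≟_ (cyclic 2) c ≤ 1
  at-most-one red   = s≤s z≤n
  at-most-one blue  = s≤s z≤n
  at-most-one green = z≤n
cyclic-balanced (suc (suc (suc n))) c d =
  subst₂ (λ a b → a ≤ b + 1) (sym (step c)) (sym (step d)) (s≤s (cyclic-balanced n c d))
  where
  step : ∀ c → #values Fin._≟_ (cyclic (3 + n)) c ≡ suc (#values Fin._≟_ (cyclic n) c)
  step red   = refl
  step blue  = refl
  step green = refl

-- The block colorings are tight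

module Blocks (k n p : ℕ) (r≤n : 3 + p ≤ n) (q : ℕ) .{{_ : NonZero n}} where

  open BalancedCompleteHypergraph k n (3 + p)
  open Counting k n (2 + p)
  open Packing n p r≤n

  -- The argument supplies colors only beyond the `3 * q` block classes, so both residues share the
  -- construction.
  blocks : Coloring → Coloring
  blocks χ v with toℕ (class v) <? q
  ... | yes _ = red
  ... | no  _ with toℕ (class v) <? 2 * q
  ...   | yes _ = blue
  ...   | no  _ with toℕ (class v) <? 3 * q
  ...     | yes _ = green
  ...     | no  _ = χ v

  threeBlocks : ∀ χ → ThreeBlocks q (blocks χ)
  threeBlocks χ v with toℕ (class v) <? q
  ... | yes i<q = (λ _ → refl) , (λ q≤i _ → contradiction i<q (≤⇒≯ q≤i)) ,
                  (λ 2q≤i _ → contradiction i<q (≤⇒≯ (≤-trans (m≤m+n q _) 2q≤i)))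
  ... | no  i≮q with toℕ (class v) <? 2 * q
  ...   | yes i<2q = (λ i<q → contradiction i<q i≮q) , (λ _ _ → refl) ,
                     (λ 2q≤i _ → contradiction i<2q (≤⇒≯ 2q≤i))
  ...   | no  i≮2q with toℕ (class v) <? 3 * q
  ...     | yes _    = (λ i<q → contradiction i<q i≮q) , (λ _ i<2q → contradiction i<2q i≮2q) , (λ _ _ → refl)
  ...     | no  i≮3q = (λ i<q → contradiction i<q i≮q) , (λ _ i<2q → contradiction i<2q i≮2q) ,
                       (λ _ i<3q → contradiction i<3q i≮3q)

  blocks-beyond : ∀ χ v → 3 * q ≤ toℕ (class v) → blocks χ v ≡ χ v
  blocks-beyond χ v 3q≤i with toℕ (class v) <? q
  ... | yes i<q = contradiction (<-≤-trans i<q (m≤m+n q _)) (≤⇒≯ 3q≤i)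
  ... | no  _ with toℕ (class v) <? 2 * q
  ...   | yes i<2q = contradiction (<-≤-trans i<2q (m≤n+m (2 * q) q)) (≤⇒≯ 3q≤i)
  ...   | no  _ with toℕ (class v) <? 3 * q
  ...     | yes i<3q = contradiction i<3q (≤⇒≯ 3q≤i)
  ...     | no  _    = refl

  lastCyclic : Coloring
  lastCyclic = blocks (cyclic n ∘ proj₂ ∘ remQuot {k} n)

  lastCyclic-balanced : k ≡ suc (3 * q) → LastClassBalanced lastCyclic
  lastCyclic-balanced k≡ i 1+i≡k c d = subst₂ (λ a b → a ≤ b + 1) (sym (count c)) (sym (count d)) (cyclic-balanced n c d)
    where
    color : ∀ j → lastCyclic (combine i j) ≡ cyclic n j
    color j = trans
      (blocks-beyond _ (combine i j) (≤-reflexive (sym (trans (cong toℕ (class-combine i j)) (suc-injective (trans 1+i≡k k≡))))))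
      (cong (cyclic n ∘ proj₂) (Fin.remQuot-combine i j))
    count : ∀ c → #colored lastCyclic i c ≡ #values Fin._≟_ (cyclic n) c
    count c = trans (#colored-combine lastCyclic i c) (sum-cong-≗ λ j → cong (λ a → ⟦ a Fin.≟ c ⟧) (color j))

  module _ (χ : Coloring) (blocked : ThreeBlocks q χ) where

    -- Keeping `g` arbitrary lets one computation serve twice: the identity gives color totals, and
    -- `B` gives the subsets contained in classes.
    monochromatic-class : ∀ d i → (∀ v → class v ≡ i → χ v ≡ d) → ∀ (g : ℕ → ℕ) → g 0 ≡ 0 →
      ∀ c → g (#colored χ i c) ≡ ⟦ d Fin.≟ c ⟧ * g n
    monochromatic-class d i all-d g g0≡0 c with d Fin.≟ c
    ... | yes refl = trans (cong g all) (sym (*-identityˡ (g n)))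
      where
      all : #colored χ i d ≡ n
      all = trans (#colored-combine χ i d) (trans
        (sum-cong-≗ λ j → ⟦⟧-true (χ (combine i j) Fin.≟ d) (all-d (combine i j) (class-combine i j))) (sum-1 n))
    ... | no d≢c = trans (cong g none) g0≡0
      where
      none : #colored χ i c ≡ 0
      none = trans (#colored-combine χ i c) (trans
        (sum-cong-≗ λ j → ⟦⟧-false (χ (combine i j) Fin.≟ c) λ eq → d≢c (trans (sym (all-d (combine i j) (class-combine i j))) eq))
        (sum-replicate-zero n))

    module _ (e : ℕ) (k≡ : k ≡ q + (q + (q + e))) where

      private
        ℓ = proj₁ (sum-blocks q e k≡)

      sum-column : ∀ (g : ℕ → ℕ) → g 0 ≡ 0 → ∀ c →
        ∑[ i < k ] g (#colored χ i c) ≡ q * g n + ∑[ j < e ] g (#colored χ (ℓ j) c)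
      sum-column g g0≡0 c = trans
        (proj₂ (proj₂ (sum-blocks q e k≡)) (λ i → g (#colored χ i c)) _ _ _
          (λ i i<q → monochromatic-class red i (λ { v refl → proj₁ (blocked v) i<q }) g g0≡0 c)
          (λ i q≤i i<2q → monochromatic-class blue i (λ { v refl → proj₁ (proj₂ (blocked v)) q≤i i<2q }) g g0≡0 c)
          (λ i 2q≤i i<3q → monochromatic-class green i (λ { v refl → proj₂ (proj₂ (blocked v)) 2q≤i i<3q }) g g0≡0 c))
        (collapse c _)
        where
        collapse : ∀ c o → q * (⟦ red Fin.≟ c ⟧ * g n) + (q * (⟦ blue Fin.≟ c ⟧ * g n) + (q * (⟦ green Fin.≟ c ⟧ * g n) + o)) ≡ q * g n + o
        collapse red   = λ o → lemma q (g n) o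
          where
          lemma : ∀ q a o → q * (1 * a) + (q * (0 * a) + (q * (0 * a) + o)) ≡ q * a + o
          lemma = solve-∀
        collapse blue  = λ o → lemma q (g n) o
          where
          lemma : ∀ q a o → q * (0 * a) + (q * (1 * a) + (q * (0 * a) + o)) ≡ q * a + o
          lemma = solve-∀
        collapse green = λ o → lemma q (g n) o
          where
          lemma : ∀ q a o → q * (0 * a) + (q * (0 * a) + (q * (1 * a) + o)) ≡ q * a + o
          lemma = solve-∀

    -- y c counts the vertices of color c outside the blocks.
    unique-minimizer : ∀ w (y : Color → ℕ) → k ≤ 1 + 3 * q → 0 < q → suc w < n →
      (∀ c → y c ≡ w ⊎ y c ≡ suc w) →
      (∀ (g : ℕ → ℕ) → g 0 ≡ 0 → ∀ c → ∑[ i < k ] g (#colored χ i c) ≡ q * g n + g (y c)) →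
      Minimizing χ × (∀ χ′ → Minimizing χ′ → χ′ ≈ χ)
    unique-minimizer w y k≤ 0<q 1+w<n y∈ column =
      tight⇒unique-minimizer q w refl 1+w<n k≤ χ (shape⇒tight χ packed balanced)
      where
      n≤m : n ≤ w + q * n
      n≤m = ≤-trans (m≤n*m n q {{>-nonZero 0<q}}) (m≤n+m (q * n) w)

      open Extremal k n p (w + q * n) r≤n n≤m

      total≡ : ∀ c → colorTotal χ c ≡ y c + q * n
      total≡ c = trans (column id refl c) (+-comm (q * n) (y c))

      y<n : ∀ c → y c < n
      y<n c with y∈ c
      ... | inj₁ y≡w   = subst (_< n) (sym y≡w) (<-trans (n<1+n w) 1+w<n)
      ... | inj₂ y≡1+w = subst (_< n) (sym y≡1+w) 1+w<n

      packed : ∀ c → contained χ c ≡ M (colorTotal χ c)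
      packed c = trans (column B B0≡0 c) (sym (trans (cong M (total≡ c)) (M-unique q (y<n c))))

      balanced : ∀ c → colorTotal χ c ≡ w + q * n ⊎ colorTotal χ c ≡ suc (w + q * n)
      balanced c with y∈ c
      ... | inj₁ y≡w   = inj₁ (trans (total≡ c) (cong (_+ q * n) y≡w))
      ... | inj₂ y≡1+w = inj₂ (trans (total≡ c) (cong (_+ q * n) y≡1+w))

    -- No class lies beyond the blocks, so `w` is 0, the tangent point is `q * n`, and every total
    -- equals it.
    unique-minimizer-0 : 0 < q → k ≡ 0 + q * 3 → Minimizing χ × (∀ χ′ → Minimizing χ′ → χ′ ≈ χ)
    unique-minimizer-0 0<q k≡ = unique-minimizer 0 (λ _ → 0)
      (≤-trans (≤-reflexive (trans k≡ (*-comm q 3))) (n≤1+n _)) 0<q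
      (≤-trans (s≤s (s≤s z≤n)) r≤n) (λ _ → inj₁ refl)
      (λ g g0≡0 c → trans (sum-column 0 (trans k≡ (rearrange q)) g g0≡0 c) (cong (q * g n +_) (sym g0≡0)))
      where
      rearrange : ∀ q → 0 + q * 3 ≡ q + (q + (q + 0))
      rearrange = solve-∀

    -- The smallest entry `w` of the last row is the integer part of a third of `n`, so `w + q * n`
    -- is the integer part of a third of `k * n`.
    unique-minimizer-1 : 0 < q → k ≡ 1 + q * 3 → LastClassBalanced χ → Minimizing χ × (∀ χ′ → Minimizing χ′ → χ′ ≈ χ)
    unique-minimizer-1 0<q k≡ last-balanced = unique-minimizer w (#colored χ last)
      (≤-reflexive (trans k≡ (cong suc (*-comm q 3)))) 0<q 1+w<n y∈
      (λ g g0≡0 c → trans (sum-column 1 k≡′ g g0≡0 c) (cong (q * g n +_) (+-identityʳ _)))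
      where
      k≡′ : k ≡ q + (q + (q + 1))
      k≡′ = trans k≡ (rearrange q)
        where
        rearrange : ∀ q → 1 + q * 3 ≡ q + (q + (q + 1))
        rearrange = solve-∀
      last : Fin k
      last = proj₁ (sum-blocks q 1 k≡′) zero
      1+last≡k : suc (toℕ last) ≡ k
      1+last≡k = trans (cong suc (proj₁ (proj₂ (sum-blocks q 1 k≡′)) zero)) (trans (rearrange q) (sym k≡))
        where
        rearrange : ∀ q → suc (3 * q + 0) ≡ 1 + q * 3
        rearrange = solve-∀
      two-valued : ∃[ w ] suc w < n × (∀ c → #colored χ last c ≡ w ⊎ #colored χ last c ≡ suc w)
      two-valued = balanced⇒two-valued (#colored χ last) (row-sum χ last) (≤-trans (m≤m+n 3 p) r≤n) (last-balanced last 1+last≡k)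
      w = proj₁ two-valued
      1+w<n = proj₁ (proj₂ two-valued)
      y∈ = proj₂ (proj₂ two-valued)

theorem4 : ∀ (n r k : ℕ) → n ≥ r → r ≥ 3 → k ≥ 3 →
    let open BalancedCompleteHypergraph k n r in
    (k % 3 ≡ 0 →
    (∃[ χ ] ThreeBlocks (k / 3) χ) ×
    (∀ χ → ThreeBlocks (k / 3) χ →
    Minimizing χ × (∀ χ′ → Minimizing χ′ → χ′ ≈ χ)))
    ×
    (k % 3 ≡ 1 →
    (∃[ χ ] (ThreeBlocks (k / 3) χ × LastClassBalanced χ)) ×
    (∀ χ → ThreeBlocks (k / 3) χ → LastClassBalanced χ →
    Minimizing χ × (∀ χ′ → Minimizing χ′ → χ′ ≈ χ)))
theorem4 n@(suc _) (suc (suc (suc p))) k r≤n (s≤s (s≤s (s≤s _))) k≥3 =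
  (λ k%3≡0 → let k≡ = k-form k%3≡0 in
    (blocks (λ _ → red) , threeBlocks _) ,
    λ χ blocked → unique-minimizer-0 χ blocked 0<q k≡) ,
  (λ k%3≡1 → let k≡ = k-form k%3≡1 in
    (lastCyclic , threeBlocks _ , lastCyclic-balanced (trans k≡ (cong suc (*-comm q 3)))) ,
    λ χ blocked balanced → unique-minimizer-1 χ blocked 0<q k≡ balanced)
  where
  q = k / 3
  open Blocks k n p r≤n q
  k-form : ∀ {e} → k % 3 ≡ e → k ≡ e + q * 3
  k-form k%3≡e = trans (m≡m%n+[m/n]*n k 3) (cong (_+ q * 3) k%3≡e)
  -- This places the tangent point at or beyond `n`, outside the flat range of slopes.
  0<q : 0 < q
  0<q = m≥n⇒m/n>0 k≥3
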